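{- For all sufficiently large $n$ there is a graph $G$ on $\Theta(n)$ vertices, all of whose vertex degrees lie in the range $[\sqrt{n},\sqrt{n}\log^3 n]$, such that for $n$ i.i.d. uniform arrivals from $E(G)$: the Greedy algorithm, even with uniformly random tie-breaking, has maximum load $\Omega(\log n/\log\log n)$ (with high probability), while the expected offline optimum satisfies $\mathrm{OPT}(G,n)=O(\log\log n)$.
   Context: Online graph balancing with i.i.d. arrivals: given a base graph $G=(V,E)$, at each step $t=1,\dots,T$ an edge $e_t$ is drawn independently and uniformly at random from $E$ (with replacement) and must be irrevocably oriented towards one of its endpoints upon arrival; the load of a vertex is the number of edges oriented into it. The Greedy algorithm orients each arriving edge towards the endpoint with currently smaller load, breaking ties uniformly at random. $\mathrm{OPT}(G,T)$ denotes the expectation, over the random sample $e_1,\dots,e_T$, of the minimum over all orientations of these sampled edges of the maximum vertex load. -}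

module Defs where

open import Data.Nat using (ℕ; zero; suc; _+_; _*_; _^_; _≤_; _<_; _<ᵇ_; _⊔_; _⊓_)
open import Data.Nat.Logarithm using (⌊log₂_⌋)
open import Data.Bool using (Bool; true; false; if_then_else_)
open import Data.Fin using (Fin; toℕ; _≟_)
open import Data.Product using (_×_; _,_; proj₁; proj₂)
open import Data.List using (List; []; _∷_; [_]; map; concatMap; allFin; length; foldr; filterᵇ)
open import Data.List.Relation.Unary.All using (All)
open import Data.List.Relation.Unary.Unique.Propositional using (Unique)
open import Data.Vec using (Vec; []; _∷_; replicate; lookup; updateAt)
open import Relation.Nullary.Decidable using (⌊_⌋)
open import Data.Nat.ListAction using (sum)

record Graph : Set where
  field
    nV     : ℕ
    edges  : List (Fin nV × Fin nV)
    ordered : All (λ e → toℕ (proj₁ e) < toℕ (proj₂ e)) edges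
    unique  : Unique edges
open Graph public

Edge : Graph → Set
Edge G = Fin (nV G) × Fin (nV G)

degree : (G : Graph) → Fin (nV G) → ℕ
degree G v = length (filterᵇ (λ e → ⌊ proj₁ e ≟ v ⌋ Data.Bool.∨ ⌊ proj₂ e ≟ v ⌋) (edges G))

seqs : {A : Set} → List A → (n : ℕ) → List (Vec A n)
seqs xs zero = [ [] ]
seqs xs (suc n) = concatMap (λ x → map (x ∷_) (seqs xs n)) xs

-- the sample space of T i.i.d. uniform arrivals from E(G): all |E|^T edge sequences,
-- each equally likely
samples : (G : Graph) → (T : ℕ) → List (Vec (Edge G) T)
samples G T = seqs (edges G) T

allBoolVecs : (T : ℕ) → List (Vec Bool T)
allBoolVecs T = seqs (true ∷ false ∷ []) T

loads : (G : Graph) → {T : ℕ} → Vec (Edge G) T → Vec Bool T → Vec ℕ (nV G)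
loads G [] [] = replicate _ 0
loads G (e ∷ es) (b ∷ bs) =
  updateAt (loads G es bs) (if b then proj₁ e else proj₂ e) suc

maxVec : {k : ℕ} → Vec ℕ k → ℕ
maxVec [] = 0
maxVec (x ∷ xs) = x ⊔ maxVec xs

opt : (G : Graph) → {T : ℕ} → Vec (Edge G) T → ℕ
opt G {T} s =
  foldr _⊓_ (maxVec (loads G s (replicate T false)))
            (map (λ o → maxVec (loads G s o)) (allBoolVecs T))

greedyStep : (G : Graph) → Vec ℕ (nV G) → Edge G → Bool → Vec ℕ (nV G)
greedyStep G ld (u , v) b =
  let lu = lookup ld u ; lv = lookup ld v
      tgt = if lu <ᵇ lv then u else (if lv <ᵇ lu then v else (if b then u else v))
  in updateAt ld tgt suc

greedyRun : (G : Graph) → {T : ℕ} → Vec ℕ (nV G) → Vec (Edge G) T → Vec Bool T → Vec ℕ (nV G)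
greedyRun G ld [] [] = ld
greedyRun G ld (e ∷ es) (b ∷ bs) = greedyRun G (greedyStep G ld e b) es bs

greedyMax : (G : Graph) → {T : ℕ} → Vec (Edge G) T → Vec Bool T → ℕ
greedyMax G s bs = maxVec (greedyRun G (replicate _ 0) s bs)

-- Sum over the sample space of OPT; E[OPT(G,T)] = optSum G T / |E|^T
optSum : (G : Graph) → (T : ℕ) → ℕ
optSum G T = sum (map (opt G) (samples G T))

-- number of (sample, tie-bit) outcomes (all equally likely, |E|^T * 2^T of them)
-- satisfying a predicate P on the greedy max load
greedyCount : (G : Graph) → (T : ℕ) → (ℕ → Bool) → ℕ
greedyCount G T P =
  sum (map (λ s → length (filterᵇ (λ bs → P (greedyMax G s bs)) (allBoolVecs T))) (samples G T))

L : ℕ → ℕ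
L n = ⌊log₂ n ⌋

LL : ℕ → ℕ
LL n = ⌊log₂ ⌊log₂ n ⌋ ⌋

{-# OPTIONS --safe #-}
module Submission where

-- The base graph is an R-ary heap whose nodes are blown up to m ≈ √n independent vertices, with R = Θ(log² n); an edge
-- joins every vertex of a node to every vertex of its parent.
--
-- Greedy: cut the arrivals into h = Θ(log n / log log n) phases.  In each phase a vertex with children sees, with
-- probability 1 - n^(-Ω(1)), at least h arrivals that lead to its children and would break a tie in its favour; call
-- them helpful.  If that holds for all vertices and phases, then after phase i every node of index < (R+1)^(h-i) has
-- load ≥ i: while the load of a vertex is at most i and its children all have load ≥ i, each helpful arrival raises it.
--
-- OPT: split the edges into stars (a node together with its children).  If no vertex set U of a star contains κ |U|
-- sampled edges, κ = Θ(log R), peeling off vertices of degree < 2κ orients the star with loads ≤ 2κ; each vertex lies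
-- in at most two stars.  A first-moment bound over all U shows that the hypothesis fails with probability ≤ 1/n.

open import Defs
open import Data.Nat
open import Data.Nat.Properties
open import Data.Nat.DivMod using (_/_; _%_; m≡m%n+[m/n]*n; m%n<n; m/n*n≤m; /-monoˡ-≤; m*n/n≡m)
open import Data.Nat.Induction using (<-rec)
open import Data.Nat.ListAction using (sum)
open import Data.Nat.ListAction.Properties using (sum-++)
open import Data.Nat.Logarithm
open import Data.Nat.Tactic.RingSolver using (solve-∀)
open import Data.Bool using (Bool; true; false; T; T?; if_then_else_; _∨_)
import Data.Bool as Bool
open import Data.Bool.Properties using (T-∨)
open import Data.Empty using (⊥-elim)
open import Data.Fin using (Fin; zero; suc; toℕ; fromℕ<; inject≤; combine; remQuot)
import Data.Fin as F
open import Data.Fin.Properties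
  using (toℕ<n; toℕ-injective; toℕ-fromℕ<; toℕ-inject≤; toℕ-combine; combine-injective; combine-monoˡ-<; combine-remQuot; remQuot-combine)
import Data.Fin.Properties as Finₚ
open import Data.Product using (Σ; ∃; _×_; _,_; proj₁; proj₂)
open import Data.Product.Properties using (,-injectiveˡ; ,-injectiveʳ)
open import Data.Sum using (_⊎_; inj₁; inj₂)
open import Data.List
  using (List; []; _∷_; _++_; map; concatMap; foldr; length; filter; filterᵇ; cartesianProduct; allFin; upTo)
open import Data.List.Properties
  using (length-++; length-++-sucʳ; length-map; length-tabulate; length-upTo; map-++; map-∘; filter-notAll)
open import Data.List.Membership.Propositional using (_∈_; find; lose)
open import Data.List.Membership.Propositional.Properties
open import Data.List.Relation.Unary.All as All using (All; []; _∷_)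
import Data.List.Relation.Unary.All.Properties as Allₚ
open import Data.List.Relation.Unary.AllPairs using ([]; _∷_)
open import Data.List.Relation.Unary.Any using (Any; here; there; any?)
open import Data.List.Relation.Unary.Unique.Propositional using (Unique)
import Data.List.Relation.Unary.Unique.Propositional.Properties as Uniqueₚ
open import Data.List.Relation.Binary.Sublist.Propositional using (_⊆_; []; _∷ʳ_; _∷_; ⊆-refl; ⊆-trans)
open import Data.List.Relation.Binary.Sublist.Propositional.Properties using (All-resp-⊆; filter-⊆; length-mono-≤)
open import Data.Vec as Vec using (Vec; []; _∷_; lookup; replicate; updateAt; zip)
open import Data.Vec.Properties using (lookup-replicate; lookup∘updateAt; lookup∘updateAt′)
open import Data.Vec.Relation.Unary.All as VecAll using ([]; _∷_)
open import Function using (_∘_; id)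
open import Function.Bundles using (Equivalence)
open import Relation.Nullary
open import Relation.Nullary.Decidable using (⌊_⌋; _×-dec_; _⊎-dec_; ¬?; toWitness; fromWitness)
open import Relation.Unary using (Decidable)
open import Relation.Binary.PropositionalEquality hiding (J)

-- Greedy is adaptive, so its loads are hard to treat probabilistically. Whether an arrival is
-- helpful depends only on the edge and its tie bit, never on the loads. Hits of a vertex are thus
-- independent over time, and all dependence is confined to a deterministic invariant. The size of R
-- balances three demands. Over n arrivals a vertex with children expects Θ(R) helpful ones. Cut
-- into at most log n phases, these must number Ω(log n) per phase to survive a union bound over
-- polynomially many windows, hence R = Θ(log² n). The heap then has depth Θ(log n / log R), which
-- is the load that Greedy builds up. A star has about (R m / u)^u vertex sets of size u, that is
-- R^u at u = m; beating them takes κ = log R + O(1), hence an optimum of O(log log n).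
-- Probabilities appear as counts of sequences with denominators cleared. Making J, R and m powers
-- of two turns size comparisons into comparisons of exponents.

private variable
  A B : Set
  P Q : Set
  n N : ℕ

-- Arithmetic

^-distribʳ-* : ∀ k m n → (m * n) ^ k ≡ m ^ k * n ^ k
^-distribʳ-* zero m n = refl
^-distribʳ-* (suc k) m n = trans (cong (m * n *_) (^-distribʳ-* k m n)) (regroup m n (m ^ k) (n ^ k))
  where
  regroup : ∀ a b c d → a * b * (c * d) ≡ a * c * (b * d)
  regroup = solve-∀

1≤^ : ∀ m k → 1 ≤ m → 1 ≤ m ^ k
1≤^ (suc m) k _ = m^n>0 (suc m) k

n<2^n : ∀ n → n < 2 ^ n
n<2^n zero = s≤s z≤n
n<2^n (suc n) = begin
  suc (suc n)         ≤⟨ s≤s (n<2^n n) ⟩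
  1 + 2 ^ n           ≤⟨ +-monoˡ-≤ (2 ^ n) (1≤^ 2 n (s≤s z≤n)) ⟩
  2 ^ n + 2 ^ n       ≡⟨ cong (2 ^ n +_) (+-identityʳ (2 ^ n)) ⟨
  2 * 2 ^ n           ∎
  where open ≤-Reasoning

binomial-two-terms : ∀ T q → T ^ suc q + suc q * T ^ q ≤ suc T ^ suc q
binomial-two-terms T zero = ≤-reflexive (two T)
  where
  two : ∀ T → T * 1 + (1 + 0) ≡ (1 + T) * 1
  two = solve-∀
binomial-two-terms T (suc q) = begin
  T * (T * x) + suc (suc q) * (T * x)                   ≤⟨ m≤m+n _ _ ⟩
  T * (T * x) + suc (suc q) * (T * x) + suc q * x       ≡⟨ regroup T x q ⟩
  suc T * (T * x + suc q * x)                           ≤⟨ *-monoʳ-≤ (suc T) (binomial-two-terms T q) ⟩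
  suc T ^ suc (suc q)                                   ∎
  where
  open ≤-Reasoning
  x = T ^ q
  regroup : ∀ T x q → T * (T * x) + (1 + (1 + q)) * (T * x) + (1 + q) * x ≡ (1 + T) * (T * x + (1 + q) * x)
  regroup = solve-∀

-- The first two terms of the expansion of (y + 1)^(y + 1) are each at least y^(y + 1). Read as (1 -
-- 1/x)^x ≤ 1/2, this is the decay rate in the Greedy bound.
2*y^x≤x^x : ∀ y → 2 * y ^ suc y ≤ suc y ^ suc y
2*y^x≤x^x y = begin
  2 * (y * y ^ y)                ≡⟨ cong (y * y ^ y +_) (+-identityʳ _) ⟩
  y * y ^ y + y * y ^ y          ≤⟨ +-monoʳ-≤ (y * y ^ y) (*-monoˡ-≤ (y ^ y) (n≤1+n y)) ⟩
  y ^ suc y + suc y * y ^ y      ≤⟨ binomial-two-terms y y ⟩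
  suc y ^ suc y                  ∎
  where open ≤-Reasoning

-- Bernoulli's inequality (1 - 1/(x+1))^s ≥ 1 - s/(x+1), cleared of denominators.
bernoulli : ∀ x d s → d + s ≡ suc x → suc x ^ s * d ≤ x ^ s * suc x
bernoulli x d zero eq = ≤-reflexive (cong (1 *_) (trans (sym (+-identityʳ d)) eq))
bernoulli x d (suc s) eq = begin
  suc x * pw * d           ≡⟨ swap (suc x) pw d ⟩
  pw * (suc x * d)         ≤⟨ *-monoʳ-≤ pw le ⟩
  pw * (suc d * x)         ≡⟨ swap′ pw (suc d) x ⟩
  x * (pw * suc d)         ≤⟨ *-monoʳ-≤ x (bernoulli x (suc d) s (trans (sym (+-suc d s)) eq)) ⟩
  x * (x ^ s * suc x)     ≡⟨ *-assoc x (x ^ s) (suc x) ⟨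
  x * x ^ s * suc x       ∎
  where
  open ≤-Reasoning
  pw = suc x ^ s
  d≤x : d ≤ x
  d≤x = s≤s⁻¹ (subst (suc d ≤_) eq (subst (_≤ d + suc s) (+-comm d 1) (+-monoʳ-≤ d (s≤s z≤n))))
  le : suc x * d ≤ suc d * x
  le = subst (_≤ suc d * x) (cong (d +_) (*-comm d x)) (+-monoˡ-≤ (d * x) d≤x)
  swap : ∀ a b c → a * b * c ≡ b * (a * c)
  swap = solve-∀
  swap′ : ∀ a b c → a * (b * c) ≡ c * (a * b)
  swap′ = solve-∀

suc^≤2* : ∀ x s → s + s ≤ suc x → suc x ^ s ≤ 2 * x ^ s
suc^≤2* x s le = *-cancelʳ-≤ _ _ (suc x) (begin
  suc x ^ s * suc x       ≤⟨ *-monoʳ-≤ (suc x ^ s) sx≤2d ⟩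
  suc x ^ s * (2 * d)     ≡⟨ swap (suc x ^ s) d ⟩
  2 * (suc x ^ s * d)     ≤⟨ *-monoʳ-≤ 2 (bernoulli x d s d+s) ⟩
  2 * (x ^ s * suc x)     ≡⟨ *-assoc 2 (x ^ s) (suc x) ⟨
  2 * x ^ s * suc x       ∎)
  where
  open ≤-Reasoning
  d = suc x ∸ s
  d+s : d + s ≡ suc x
  d+s = m∸n+n≡m (≤-trans (m≤m+n s s) le)
  swap : ∀ a b → a * (2 * b) ≡ 2 * (a * b)
  swap = solve-∀
  sx≤2d : suc x ≤ 2 * d
  sx≤2d = begin
    suc x     ≡⟨ d+s ⟨
    d + s     ≤⟨ +-monoʳ-≤ d (+-cancelʳ-≤ s s d (≤-trans le (≤-reflexive (sym d+s)))) ⟩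
    d + d     ≡⟨ cong (d +_) (+-identityʳ d) ⟨
    2 * d     ∎

-- (1 + 1/q)^q ≤ 4: the exponent is split into two halves, each contributing a factor 2.
suc^≤4* : ∀ q → suc q ^ q ≤ 4 * q ^ q
suc^≤4* q = begin
  suc q ^ q                              ≡⟨ cong (suc q ^_) q≡ ⟨
  suc q ^ (a + b)                        ≡⟨ ^-distribˡ-+-* (suc q) a b ⟩
  suc q ^ a * suc q ^ b                  ≤⟨ *-mono-≤ (suc^≤2* q a a≤) (suc^≤2* q b b≤) ⟩
  (2 * q ^ a) * (2 * q ^ b)              ≡⟨ regroup (q ^ a) (q ^ b) ⟩
  4 * (q ^ a * q ^ b)                    ≡⟨ cong (4 *_) (^-distribˡ-+-* q a b) ⟨
  4 * q ^ (a + b)                        ≡⟨ cong (λ t → 4 * q ^ t) q≡ ⟩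
  4 * q ^ q                              ∎
  where
  open ≤-Reasoning
  a = ⌊ q /2⌋
  b = ⌈ q /2⌉
  q≡ : a + b ≡ q
  q≡ = ⌊n/2⌋+⌈n/2⌉≡n q
  b≤ : b + b ≤ suc q
  b≤ = ≤-trans (+-monoʳ-≤ b (⌊n/2⌋-mono (n≤1+n (suc q)))) (≤-reflexive (⌊n/2⌋+⌈n/2⌉≡n (suc q)))
  a≤ : a + a ≤ suc q
  a≤ = ≤-trans (+-mono-≤ (⌊n/2⌋≤⌈n/2⌉ q) (⌊n/2⌋≤⌈n/2⌉ q)) b≤
  regroup : ∀ x y → (2 * x) * (2 * y) ≡ 4 * (x * y)
  regroup = solve-∀

-- A weak Stirling bound with 4 in place of e. It trades the factorials of the subset count and of
-- the tail bound for powers.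
n^n≤4^n*n! : ∀ q → q ^ q ≤ 4 ^ q * q !
n^n≤4^n*n! zero = ≤-refl
n^n≤4^n*n! (suc q) = begin
  suc q * suc q ^ q                ≤⟨ *-monoʳ-≤ (suc q) (suc^≤4* q) ⟩
  suc q * (4 * q ^ q)              ≤⟨ *-monoʳ-≤ (suc q) (*-monoʳ-≤ 4 (n^n≤4^n*n! q)) ⟩
  suc q * (4 * (4 ^ q * q !))      ≡⟨ regroup (suc q) (4 ^ q) (q !) ⟩
  4 * 4 ^ q * (suc q * q !)        ∎
  where
  open ≤-Reasoning
  regroup : ∀ a b c → a * (4 * (b * c)) ≡ 4 * b * (a * c)
  regroup = solve-∀

-- One factor i ≤ u is absorbed by 2^u and the others are at most m, which leaves an m to spare.
-- Thus (i / 2m)^u ≤ 1/m even for the smallest sets; `core-count` uses the fifth power.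
m*i^u≤2^u*m^u : ∀ m i u → i ≤ m → i ≤ u → 1 ≤ u → m * i ^ u ≤ 2 ^ u * m ^ u
m*i^u≤2^u*m^u m i (suc u) i≤m i≤u _ = begin
  m * (i * i ^ u)            ≤⟨ *-monoʳ-≤ m (*-mono-≤ (≤-trans i≤u (<⇒≤ (n<2^n (suc u)))) (^-monoˡ-≤ u i≤m)) ⟩
  m * (2 ^ suc u * m ^ u)    ≡⟨ regroup m (2 ^ suc u) (m ^ u) ⟩
  2 ^ suc u * (m * m ^ u)    ∎
  where
  open ≤-Reasoning
  regroup : ∀ a b c → a * (b * c) ≡ b * (a * c)
  regroup = solve-∀

n<2^[1+log] : ∀ n → n < 2 ^ suc ⌊log₂ n ⌋
n<2^[1+log] n = ≰⇒> λ le → 1+n≰n (subst (_≤ ⌊log₂ n ⌋) (⌊log₂[2^n]⌋≡n (suc ⌊log₂ n ⌋)) (⌊log₂⌋-mono-≤ le))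

2^log≤n : ∀ n → 1 ≤ n → 2 ^ ⌊log₂ n ⌋ ≤ n
2^log≤n = <-rec _ step
  where
  open ≤-Reasoning
  step : ∀ n → (∀ {k} → k < n → 1 ≤ k → 2 ^ ⌊log₂ k ⌋ ≤ k) → 1 ≤ n → 2 ^ ⌊log₂ n ⌋ ≤ n
  step n rec 1≤n with ⌊log₂ n ⌋ in eq
  ... | zero = 1≤n
  ... | suc l = begin
    2 * 2 ^ l           ≤⟨ *-monoʳ-≤ 2 half ⟩
    2 * ⌊ n /2⌋         ≡⟨ cong (⌊ n /2⌋ +_) (+-identityʳ _) ⟩
    ⌊ n /2⌋ + ⌊ n /2⌋   ≤⟨ +-monoʳ-≤ ⌊ n /2⌋ (⌊n/2⌋≤⌈n/2⌉ n) ⟩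
    ⌊ n /2⌋ + ⌈ n /2⌉   ≡⟨ ⌊n/2⌋+⌈n/2⌉≡n n ⟩
    n                   ∎
    where
    2≤n : 2 ≤ n
    2≤n = ≰⇒> λ n≤1 → case-n (subst (λ k → ⌊log₂ k ⌋ ≡ suc l) (≤-antisym n≤1 1≤n) eq)
      where
      case-n : ⌊log₂ 1 ⌋ ≡ suc l → _
      case-n ()
    half : 2 ^ l ≤ ⌊ n /2⌋
    half = subst (λ t → 2 ^ t ≤ ⌊ n /2⌋) (trans (⌊log₂⌊n/2⌋⌋≡⌊log₂n⌋∸1 n) (cong (_∸ 1) eq))
             (rec (⌊n/2⌋<n′ n 1≤n) (⌊n/2⌋-mono 2≤n))
      where
      ⌊n/2⌋<n′ : ∀ k → 1 ≤ k → ⌊ k /2⌋ < k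
      ⌊n/2⌋<n′ (suc k) _ = ⌊n/2⌋<n k

-- S counts pairs of a u-subset of a star (C subsets in all) and a sample of total weight M that puts κ u edges
-- inside the subset; i bounds the smaller side of the subset.
core-count : ∀ (u κ′ m R C S i N M : ℕ) → let κ = 6 + κ′ in
  1 ≤ u → 1 ≤ m → 1 ≤ R → 8 ≤ κ → 2 ^ κ ≡ 8 * R * 32 → i ≤ u → i ≤ m → 4 * N ≤ 8 * R * m →
  C * u ! ≤ N ^ u →
  (κ * u) ! * (m * (m * m)) ^ (κ * u) * S ≤ C * ((m * m * (u * i)) ^ (κ * u) * M) →
  m ^ 5 * S ≤ M
core-count u κ′ m R C S i N M 1≤u 1≤m 1≤R 8≤κ 2^κ i≤u i≤m 4N≤ C≤ S≤ = last
  where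
  open ≤-Reasoning
  κ = 6 + κ′
  q = κ * u
  E = m * (m * m)
  D = 4 * (m * m * u)
  K = u * (8 * R) * (m * m ^ κ′)

  nz : ∀ {a} → 1 ≤ a → NonZero a
  nz = >-nonZero

  -- With factorials replaced by powers: at most (4N/u)^u subsets, each dense with probability at
  -- most (4 m² u i / (q m³))^q.
  step₁ : u ^ u * ((q * E) ^ q * S) ≤ (4 * N) ^ u * ((4 * (m * m * (u * i))) ^ q * M)
  step₁ = begin
    u ^ u * ((q * E) ^ q * S)                                        ≡⟨ cong (λ t → u ^ u * (t * S)) (^-distribʳ-* q q E) ⟩
    u ^ u * (q ^ q * E ^ q * S)                                      ≤⟨ *-mono-≤ (n^n≤4^n*n! u) (*-monoˡ-≤ S (*-monoˡ-≤ (E ^ q) (n^n≤4^n*n! q))) ⟩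
    4 ^ u * u ! * (4 ^ q * q ! * E ^ q * S)                          ≡⟨ regroup (4 ^ u) (u !) (4 ^ q) (q !) (E ^ q) S ⟩
    4 ^ u * 4 ^ q * u ! * (q ! * E ^ q * S)                          ≤⟨ *-monoʳ-≤ (4 ^ u * 4 ^ q * u !) S≤ ⟩
    4 ^ u * 4 ^ q * u ! * (C * (X ^ q * M))                          ≡⟨ regroup′ (4 ^ u) (4 ^ q) (u !) C (X ^ q) M ⟩
    C * u ! * (4 ^ u * (4 ^ q * X ^ q * M))                          ≤⟨ *-monoˡ-≤ _ C≤ ⟩
    N ^ u * (4 ^ u * (4 ^ q * X ^ q * M))                            ≡⟨ regroup″ (N ^ u) (4 ^ u) _ ⟩
    4 ^ u * N ^ u * (4 ^ q * X ^ q * M)                              ≡⟨ cong₂ (λ s t → s * (t * M)) (^-distribʳ-* u 4 N) (^-distribʳ-* q 4 X) ⟨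
    (4 * N) ^ u * ((4 * X) ^ q * M) ∎
    where
    X = m * m * (u * i)
    regroup : ∀ a b c d e f → a * b * (c * d * e * f) ≡ a * c * b * (d * e * f)
    regroup = solve-∀
    regroup′ : ∀ a b c d e f → a * b * c * (d * (e * f)) ≡ d * c * (a * (b * e * f))
    regroup′ = solve-∀
    regroup″ : ∀ a b c → a * (b * c) ≡ b * a * c
    regroup″ = solve-∀

  -- Since q = κ u and κ ≥ 8, each of the q factors is at most i / 2m.
  step₂ : u ^ u * ((2 * m) ^ q * S) ≤ (4 * N) ^ u * (i ^ q * M)
  step₂ = *-cancelˡ-≤ (D ^ q) {{m^n≢0 D q {{nz (*-mono-≤ {1} {4} (s≤s z≤n) (*-mono-≤ (*-mono-≤ 1≤m 1≤m) 1≤u))}}}} (begin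
    D ^ q * (u ^ u * ((2 * m) ^ q * S))                              ≡⟨ regroup (D ^ q) (u ^ u) ((2 * m) ^ q) S ⟩
    u ^ u * ((2 * m) ^ q * D ^ q * S)                                ≡⟨ cong (λ t → u ^ u * (t * S)) (^-distribʳ-* q (2 * m) D) ⟨
    u ^ u * ((2 * m * D) ^ q * S)                                    ≤⟨ *-monoʳ-≤ (u ^ u) (*-monoˡ-≤ S (^-monoˡ-≤ q base)) ⟩
    u ^ u * ((q * E) ^ q * S)                                        ≤⟨ step₁ ⟩
    (4 * N) ^ u * ((4 * (m * m * (u * i))) ^ q * M)                  ≡⟨ cong (λ t → (4 * N) ^ u * (t ^ q * M)) (base′ m u i) ⟩
    (4 * N) ^ u * ((i * D) ^ q * M)                                  ≡⟨ cong (λ t → (4 * N) ^ u * (t * M)) (^-distribʳ-* q i D) ⟩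
    (4 * N) ^ u * (i ^ q * D ^ q * M)                                ≡⟨ regroup (D ^ q) ((4 * N) ^ u) (i ^ q) M ⟨
    D ^ q * ((4 * N) ^ u * (i ^ q * M)) ∎)
    where
    regroup : ∀ d a b c → d * (a * (b * c)) ≡ a * (b * d * c)
    regroup = solve-∀
    base′ : ∀ m u i → 4 * (m * m * (u * i)) ≡ i * (4 * (m * m * u))
    base′ = solve-∀
    base : 2 * m * D ≤ q * E
    base = begin
      2 * m * D                        ≡⟨ eq₁ m u ⟩
      8 * (u * (m * (m * m)))          ≤⟨ *-monoˡ-≤ (u * (m * (m * m))) 8≤κ ⟩
      κ * (u * (m * (m * m)))          ≡⟨ *-assoc κ u E ⟨
      q * E ∎
      where
      eq₁ : ∀ m u → 2 * m * (4 * (m * m * u)) ≡ 8 * (u * (m * (m * m)))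
      eq₁ = solve-∀

  -- The value 2^κ = 256 R absorbs the 8R of 4N ≤ 8Rm and leaves 1/32 per vertex of the subset. Of
  -- the κ factors i/m, one cancels m/u because i ≤ u, and five are kept; hence the form 6 + κ′.
  baseˡ : u * (2 * m) ^ κ ≡ K * (32 * m ^ 5)
  baseˡ = begin-equality
    u * (2 * m) ^ κ                                        ≡⟨ cong (u *_) (^-distribʳ-* κ 2 m) ⟩
    u * (2 ^ κ * m ^ κ)                                    ≡⟨ cong₂ (λ s t → u * (s * t)) 2^κ (^-distribˡ-+-* m 6 κ′) ⟩
    u * (8 * R * 32 * (m ^ 6 * m ^ κ′))                    ≡⟨ regroup u R m (m ^ 5) (m ^ κ′) ⟩
    K * (32 * m ^ 5) ∎
    where
    regroup : ∀ u R m a b → u * (8 * R * 32 * (m * a * b)) ≡ u * (8 * R) * (m * b) * (32 * a)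
    regroup = solve-∀

  baseʳ : 4 * N * i ^ κ ≤ K * i ^ 5
  baseʳ = begin
    4 * N * i ^ κ                                          ≡⟨ cong (4 * N *_) (^-distribˡ-+-* i 6 κ′) ⟩
    4 * N * (i * i ^ 5 * i ^ κ′)                           ≤⟨ *-mono-≤ 4N≤ (*-mono-≤ (*-monoˡ-≤ (i ^ 5) i≤u) (^-monoˡ-≤ κ′ i≤m)) ⟩
    8 * R * m * (u * i ^ 5 * m ^ κ′)                       ≡⟨ regroup R m u (i ^ 5) (m ^ κ′) ⟩
    K * i ^ 5 ∎
    where
    regroup : ∀ R m u a b → 8 * R * m * (u * a * b) ≡ u * (8 * R) * (m * b) * a
    regroup = solve-∀

  1≤K : 1 ≤ K
  1≤K = *-mono-≤ (*-mono-≤ 1≤u (*-mono-≤ {1} {8} (s≤s z≤n) 1≤R)) (*-mono-≤ 1≤m (1≤^ m κ′ 1≤m))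

  step₃ : (32 * m ^ 5) ^ u * S ≤ (i ^ 5) ^ u * M
  step₃ = *-cancelˡ-≤ (K ^ u) {{m^n≢0 K u {{nz 1≤K}}}} (begin
    K ^ u * ((32 * m ^ 5) ^ u * S)                ≡⟨ *-assoc (K ^ u) _ S ⟨
    K ^ u * (32 * m ^ 5) ^ u * S                  ≡⟨ cong (_* S) (^-distribʳ-* u K (32 * m ^ 5)) ⟨
    (K * (32 * m ^ 5)) ^ u * S                    ≡⟨ cong (λ t → t ^ u * S) baseˡ ⟨
    (u * (2 * m) ^ κ) ^ u * S                     ≡⟨ split u (2 * m) S ⟩
    u ^ u * ((2 * m) ^ q * S)                     ≤⟨ step₂ ⟩
    (4 * N) ^ u * (i ^ q * M)                     ≡⟨ split (4 * N) i M ⟨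
    (4 * N * i ^ κ) ^ u * M                       ≤⟨ *-monoˡ-≤ M (^-monoˡ-≤ u baseʳ) ⟩
    (K * i ^ 5) ^ u * M                           ≡⟨ cong (_* M) (^-distribʳ-* u K (i ^ 5)) ⟩
    K ^ u * (i ^ 5) ^ u * M                       ≡⟨ *-assoc (K ^ u) _ M ⟩
    K ^ u * ((i ^ 5) ^ u * M) ∎)
    where
    split : ∀ a b c → (a * b ^ κ) ^ u * c ≡ a ^ u * (b ^ q * c)
    split a b c = trans (cong (_* c) (trans (^-distribʳ-* u a (b ^ κ)) (cong (a ^ u *_) (^-*-assoc b κ u)))) (*-assoc (a ^ u) (b ^ q) c)

  i^5u : m ^ 5 * (i ^ 5) ^ u ≤ (32 * m ^ 5) ^ u
  i^5u = begin
    m ^ 5 * (i ^ 5) ^ u          ≡⟨ cong (m ^ 5 *_) (flip i) ⟩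
    m ^ 5 * (i ^ u) ^ 5          ≡⟨ ^-distribʳ-* 5 m (i ^ u) ⟨
    (m * i ^ u) ^ 5              ≤⟨ ^-monoˡ-≤ 5 (m*i^u≤2^u*m^u m i u i≤m i≤u 1≤u) ⟩
    (2 ^ u * m ^ u) ^ 5          ≡⟨ cong (_^ 5) (^-distribʳ-* u 2 m) ⟨
    ((2 * m) ^ u) ^ 5            ≡⟨ flip (2 * m) ⟨
    ((2 * m) ^ 5) ^ u            ≡⟨ cong (_^ u) (^-distribʳ-* 5 2 m) ⟩
    (32 * m ^ 5) ^ u ∎
    where
    flip : ∀ a → (a ^ 5) ^ u ≡ (a ^ u) ^ 5
    flip a = trans (^-*-assoc a 5 u) (trans (cong (a ^_) (*-comm 5 u)) (sym (^-*-assoc a u 5)))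

  last : m ^ 5 * S ≤ M
  last = *-cancelˡ-≤ ((32 * m ^ 5) ^ u) {{m^n≢0 _ u {{nz (*-mono-≤ {1} {32} (s≤s z≤n) (1≤^ m 5 1≤m))}}}} (begin
    (32 * m ^ 5) ^ u * (m ^ 5 * S)      ≡⟨ regroup ((32 * m ^ 5) ^ u) (m ^ 5) S ⟩
    m ^ 5 * ((32 * m ^ 5) ^ u * S)      ≤⟨ *-monoʳ-≤ (m ^ 5) step₃ ⟩
    m ^ 5 * ((i ^ 5) ^ u * M)           ≡⟨ *-assoc (m ^ 5) _ M ⟨
    m ^ 5 * (i ^ 5) ^ u * M             ≤⟨ *-monoˡ-≤ M i^5u ⟩
    (32 * m ^ 5) ^ u * M ∎)
    where
    regroup : ∀ a b c → a * (b * c) ≡ b * (a * c)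
    regroup = solve-∀

-- Counting

𝟙 : Dec P → ℕ
𝟙 d = if ⌊ d ⌋ then 1 else 0

𝟙≤1 : (d : Dec P) → 𝟙 d ≤ 1
𝟙≤1 (yes _) = ≤-refl
𝟙≤1 (no _) = z≤n

𝟙-yes : (d : Dec P) → P → 𝟙 d ≡ 1
𝟙-yes (yes _) _ = refl
𝟙-yes (no ¬p) p = ⊥-elim (¬p p)

𝟙-no : (d : Dec P) → ¬ P → 𝟙 d ≡ 0
𝟙-no (no _) _ = refl
𝟙-no (yes p) ¬p = ⊥-elim (¬p p)

𝟙-mono : (d : Dec P) (e : Dec Q) → (P → Q) → 𝟙 d ≤ 𝟙 e
𝟙-mono (yes p) e f = ≤-reflexive (sym (𝟙-yes e (f p)))
𝟙-mono (no _) e f = z≤n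

∑ : List A → (A → ℕ) → ℕ
∑ xs f = sum (map f xs)

∑-mono-∈ : ∀ (xs : List A) {f g} → (∀ {x} → x ∈ xs → f x ≤ g x) → ∑ xs f ≤ ∑ xs g
∑-mono-∈ [] le = z≤n
∑-mono-∈ (x ∷ xs) le = +-mono-≤ (le (here refl)) (∑-mono-∈ xs (le ∘ there))

∑-mono : ∀ (xs : List A) {f g} → (∀ x → f x ≤ g x) → ∑ xs f ≤ ∑ xs g
∑-mono xs le = ∑-mono-∈ xs (λ {x} _ → le x)

∑-cong : ∀ (xs : List A) {f g} → (∀ x → f x ≡ g x) → ∑ xs f ≡ ∑ xs g
∑-cong [] eq = refl
∑-cong (x ∷ xs) eq = cong₂ _+_ (eq x) (∑-cong xs eq)

∑-+ : ∀ (xs : List A) f g → ∑ xs (λ x → f x + g x) ≡ ∑ xs f + ∑ xs g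
∑-+ [] f g = refl
∑-+ (x ∷ xs) f g = trans (cong (f x + g x +_) (∑-+ xs f g)) (regroup (f x) (g x) (∑ xs f) (∑ xs g))
  where
  regroup : ∀ a b c d → a + b + (c + d) ≡ a + c + (b + d)
  regroup = solve-∀

∑-* : ∀ (xs : List A) c f → ∑ xs (λ x → c * f x) ≡ c * ∑ xs f
∑-* [] c f = sym (*-zeroʳ c)
∑-* (x ∷ xs) c f = trans (cong (c * f x +_) (∑-* xs c f)) (sym (*-distribˡ-+ c (f x) (∑ xs f)))

∑-const : ∀ (xs : List A) c → ∑ xs (λ _ → c) ≡ length xs * c
∑-const [] c = refl
∑-const (x ∷ xs) c = cong (c +_) (∑-const xs c)

∑-≤const : ∀ (xs : List A) {f} c → (∀ {x} → x ∈ xs → f x ≤ c) → ∑ xs f ≤ length xs * c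
∑-≤const xs c le = ≤-trans (∑-mono-∈ xs le) (≤-reflexive (∑-const xs c))

∑-++ : ∀ (xs ys : List A) f → ∑ (xs ++ ys) f ≡ ∑ xs f + ∑ ys f
∑-++ xs ys f = trans (cong sum (map-++ f xs ys)) (sum-++ (map f xs) (map f ys))

∑-map : ∀ (g : A → B) xs f → ∑ (map g xs) f ≡ ∑ xs (f ∘ g)
∑-map g xs f = cong sum (sym (map-∘ xs))

∑-concatMap : ∀ (g : A → List B) xs f → ∑ (concatMap g xs) f ≡ ∑ xs (λ x → ∑ (g x) f)
∑-concatMap g [] f = refl
∑-concatMap g (x ∷ xs) f = trans (∑-++ (g x) (concatMap g xs) f) (cong (∑ (g x) f +_) (∑-concatMap g xs f))

∑-swap : ∀ (xs : List A) (ys : List B) (f : A → B → ℕ) → ∑ xs (λ x → ∑ ys (f x)) ≡ ∑ ys (λ y → ∑ xs (λ x → f x y))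
∑-swap [] ys f = sym (trans (∑-const ys 0) (*-zeroʳ (length ys)))
∑-swap (x ∷ xs) ys f = trans (cong (∑ ys (f x) +_) (∑-swap xs ys f)) (sym (∑-+ ys (f x) (λ y → ∑ xs (λ x → f x y))))

term≤∑ : ∀ {xs : List A} {x} f → x ∈ xs → f x ≤ ∑ xs f
term≤∑ f (here refl) = m≤m+n _ _
term≤∑ {xs = y ∷ ys} f (there x∈) = ≤-trans (term≤∑ f x∈) (m≤n+m _ (f y))

∑<⇒∃< : ∀ (xs : List A) f k → ∑ xs f < k * length xs → ∃ λ x → x ∈ xs × f x < k
∑<⇒∃< [] f k lt = ⊥-elim (n≮0 (subst (0 <_) (*-zeroʳ k) lt))
∑<⇒∃< (x ∷ xs) f k lt with f x <? k
... | yes fx<k = x , here refl , fx<k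
... | no fx≮k = let (y , y∈ , fy<k) = ∑<⇒∃< xs f k rest in y , there y∈ , fy<k
  where
  rest : ∑ xs f < k * length xs
  rest = +-cancelˡ-< k _ _ (≤-<-trans (+-monoˡ-≤ (∑ xs f) (≮⇒≥ fx≮k))
           (subst (f x + ∑ xs f <_) (*-suc k (length xs)) lt))

length-filterᵇ : ∀ (p : A → Bool) xs → length (filterᵇ p xs) ≡ ∑ xs (λ x → 𝟙 (T? (p x)))
length-filterᵇ p [] = refl
length-filterᵇ p (x ∷ xs) with p x
... | true = cong suc (length-filterᵇ p xs)
... | false = length-filterᵇ p xs

length-filter≡∑ : ∀ {P : A → Set} (P? : Decidable P) xs → length (filter P? xs) ≡ ∑ xs (λ x → 𝟙 (P? x))
length-filter≡∑ P? [] = refl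
length-filter≡∑ P? (x ∷ xs) with P? x
... | yes _ = cong suc (length-filter≡∑ P? xs)
... | no _ = length-filter≡∑ P? xs

-- A pointwise union bound. The contrapositive form fits its uses, where the absence of bad
-- witnesses makes a sample good.
𝟙≤∑𝟙 : ∀ {Q : A → Set} (d : Dec P) (Q? : Decidable Q) xs →
         (¬ Any Q xs → ¬ P) → 𝟙 d ≤ ∑ xs (λ x → 𝟙 (Q? x))
𝟙≤∑𝟙 d Q? xs imp with any? Q? xs
... | yes a = let (x , x∈ , q) = find a in
  ≤-trans (𝟙≤1 d) (≤-trans (≤-reflexive (sym (𝟙-yes (Q? x) q))) (term≤∑ (λ x → 𝟙 (Q? x)) x∈))
... | no ¬a = ≤-trans (≤-reflexive (𝟙-no d (imp ¬a))) z≤n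

-- The source of the cardinality estimates on the graph: degrees, edges inside a set and helpful
-- arrivals are all compared with explicit lists through it.
Unique⇒length≤ : ∀ {xs ys : List A} → Unique xs → (∀ {x} → x ∈ xs → x ∈ ys) → length xs ≤ length ys
Unique⇒length≤ [] sub = z≤n
Unique⇒length≤ {xs = x ∷ xs} u@(_ ∷ u′) sub with ∈-∃++ (sub (here refl))
... | as , bs , refl = ≤-trans (s≤s (Unique⇒length≤ u′ sub′)) (≤-reflexive (sym (length-++-sucʳ as x bs)))
  where
  sub′ : ∀ {y} → y ∈ xs → y ∈ as ++ bs
  sub′ y∈ with ∈-++⁻ as (sub (there y∈))
  ... | inj₁ y∈as = ∈-++⁺ˡ y∈as
  ... | inj₂ (here refl) = ⊥-elim (Uniqueₚ.Unique[x∷xs]⇒x∉xs u y∈)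
  ... | inj₂ (there y∈bs) = ∈-++⁺ʳ as y∈bs

Unique⇒∑≟≤1 : ∀ (_≟_ : (x y : A) → Dec (x ≡ y)) {xs : List A} → Unique xs → ∀ v → ∑ xs (λ w → 𝟙 (v ≟ w)) ≤ 1
Unique⇒∑≟≤1 _≟_ [] v = z≤n
Unique⇒∑≟≤1 _≟_ {x ∷ xs} (x≢ ∷ u) v with v ≟ x
... | no _ = Unique⇒∑≟≤1 _≟_ u v
... | yes refl = s≤s (≤-trans (∑-≤const xs 0 λ {w} w∈ → ≤-reflexive (𝟙-no (v ≟ w) (All.lookup x≢ w∈)))
                   (≤-reflexive (*-zeroʳ (length xs))))

Unique-resp-⊆ : ∀ {xs ys : List A} → xs ⊆ ys → Unique ys → Unique xs
Unique-resp-⊆ [] [] = []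
Unique-resp-⊆ (y ∷ʳ sub) (_ ∷ u) = Unique-resp-⊆ sub u
Unique-resp-⊆ (refl ∷ sub) (x≢ ∷ u) = All-resp-⊆ sub x≢ ∷ Unique-resp-⊆ sub u

-- Sublists keep the order of `xs`, so in a duplicate-free list every u-subset occurs exactly once.
-- Peeling deletes vertices by filtering and never leaves this family.
combinations : ℕ → List A → List (List A)
combinations zero xs = [] ∷ []
combinations (suc u) [] = []
combinations (suc u) (x ∷ xs) = map (x ∷_) (combinations u xs) ++ combinations (suc u) xs

∈-combinations⁺ : ∀ {us xs : List A} → us ⊆ xs → us ∈ combinations (length us) xs
∈-combinations⁺ [] = here refl
∈-combinations⁺ {us = []} (y ∷ʳ sub) = here refl
∈-combinations⁺ {us = u ∷ us} {xs = y ∷ xs} (y ∷ʳ sub) =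
  ∈-++⁺ʳ (map (y ∷_) (combinations (length us) xs)) (∈-combinations⁺ sub)
∈-combinations⁺ (refl ∷ sub) = ∈-++⁺ˡ (∈-map⁺ _ (∈-combinations⁺ sub))

∈-combinations⁻ : ∀ u (xs : List A) {us} → us ∈ combinations u xs → us ⊆ xs × length us ≡ u
∈-combinations⁻ zero [] (here refl) = [] , refl
∈-combinations⁻ zero (x ∷ xs) (here refl) = (x ∷ʳ proj₁ (∈-combinations⁻ zero xs (here refl))) , refl
∈-combinations⁻ (suc u) (x ∷ xs) us∈ with ∈-++⁻ (map (x ∷_) (combinations u xs)) us∈
... | inj₂ us∈′ = let (sub , eq) = ∈-combinations⁻ (suc u) xs us∈′ in (x ∷ʳ sub) , eq
... | inj₁ us∈′ with ∈-map⁻ (x ∷_) us∈′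
... | ws , ws∈ , refl = let (sub , eq) = ∈-combinations⁻ u xs ws∈ in (refl ∷ sub) , cong suc eq

-- Pascal's recursion, matched with `binomial-two-terms`.
length-combinations : ∀ u (xs : List A) → length (combinations u xs) * u ! ≤ length xs ^ u
length-combinations zero xs = ≤-refl
length-combinations (suc u) [] = z≤n
length-combinations (suc u) (x ∷ xs) = begin
  length (map (x ∷_) (combinations u xs) ++ combinations (suc u) xs) * suc u !
    ≡⟨ cong (_* suc u !) (trans (length-++ (map (x ∷_) (combinations u xs))) (cong (_+ c′) (length-map (x ∷_) (combinations u xs)))) ⟩
  (c + c′) * (suc u * u !)
    ≡⟨ regroup c c′ (suc u) (u !) ⟩
  c′ * (suc u * u !) + suc u * (c * u !)
    ≤⟨ +-mono-≤ (length-combinations (suc u) xs) (*-monoʳ-≤ (suc u) (length-combinations u xs)) ⟩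
  length xs ^ suc u + suc u * length xs ^ u
    ≤⟨ binomial-two-terms (length xs) u ⟩
  suc (length xs) ^ suc u ∎
  where
  open ≤-Reasoning
  c = length (combinations u xs)
  c′ = length (combinations (suc u) xs)
  regroup : ∀ c d s f → (c + d) * (s * f) ≡ d * (s * f) + s * (c * f)
  regroup = solve-∀

-- Uniform random sequences and tail bounds

∑-seqs-suc : ∀ (xs : List A) n f → ∑ (seqs xs (suc n)) f ≡ ∑ xs (λ x → ∑ (seqs xs n) (λ s → f (x ∷ s)))
∑-seqs-suc xs n f = trans (∑-concatMap (λ x → map (x ∷_) (seqs xs n)) xs f)
  (∑-cong xs (λ x → ∑-map (x ∷_) (seqs xs n) f))

∑-seqs-1 : ∀ (xs : List A) n → ∑ (seqs xs n) (λ _ → 1) ≡ length xs ^ n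
∑-seqs-1 xs zero = refl
∑-seqs-1 xs (suc n) = trans (∑-seqs-suc xs n (λ _ → 1))
  (trans (∑-cong xs (λ _ → ∑-seqs-1 xs n)) (∑-const xs (length xs ^ n)))

∈-seqs⁻ : ∀ (xs : List A) n {s} → s ∈ seqs xs n → VecAll.All (_∈ xs) s
∈-seqs⁻ xs zero (here refl) = []
∈-seqs⁻ xs (suc n) s∈ with find (∈-concatMap⁻ (λ x → map (x ∷_) (seqs xs n)) {xs = xs} s∈)
... | x , x∈ , s∈′ with ∈-map⁻ (x ∷_) s∈′
... | s , s∈″ , refl = x∈ ∷ ∈-seqs⁻ xs n s∈″

cnt : ∀ {P : A → Set} → Decidable P → Vec A n → ℕ
cnt P? [] = 0
cnt P? (x ∷ xs) = 𝟙 (P? x) + cnt P? xs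

cnt≤n : ∀ {P : A → Set} (P? : Decidable P) (xs : Vec A n) → cnt P? xs ≤ n
cnt≤n P? [] = z≤n
cnt≤n P? (x ∷ xs) = +-mono-≤ (𝟙≤1 (P? x)) (cnt≤n P? xs)

cnt-mono : ∀ {P Q : A → Set} (P? : Decidable P) (Q? : Decidable Q) (xs : Vec A n) →
  (∀ {x} → P x → Q x) → cnt P? xs ≤ cnt Q? xs
cnt-mono P? Q? [] imp = z≤n
cnt-mono P? Q? (x ∷ xs) imp = +-mono-≤ (𝟙-mono (P? x) (Q? x) imp) (cnt-mono P? Q? xs imp)

cnt-⊎ : ∀ {P Q Q′ S : A → Set} (P? : Decidable P) (Q? : Decidable Q) (Q′? : Decidable Q′) {s : Vec A n} →
  VecAll.All S s → (∀ {x} → S x → P x → Q x ⊎ Q′ x) → cnt P? s ≤ cnt Q? s + cnt Q′? s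
cnt-⊎ P? Q? Q′? [] imp = z≤n
cnt-⊎ {Q = Q} {Q′ = Q′} P? Q? Q′? {x ∷ s} (r ∷ rs) imp = ≤-trans (+-mono-≤ head (cnt-⊎ P? Q? Q′? rs imp))
  (≤-reflexive (regroup (𝟙 (Q? x)) (𝟙 (Q′? x)) (cnt Q? s) (cnt Q′? s)))
  where
  regroup : ∀ a b c d → a + b + (c + d) ≡ a + c + (b + d)
  regroup = solve-∀
  head : 𝟙 (P? x) ≤ 𝟙 (Q? x) + 𝟙 (Q′? x)
  head with P? x
  ... | no _ = z≤n
  ... | yes p with imp r p
  ...   | inj₁ q = ≤-trans (≤-reflexive (sym (𝟙-yes (Q? x) q))) (m≤m+n _ _)
  ...   | inj₂ q = ≤-trans (≤-reflexive (sym (𝟙-yes (Q′? x) q))) (m≤n+m _ (𝟙 (Q? x)))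

-- Union bound over the q positions that hit P, written with q! and |xs|^q cleared from the denominators.
cnt-tail : ∀ {P : A → Set} (P? : Decidable P) (xs : List A) n q →
  q ! * length xs ^ q * ∑ (seqs xs n) (λ s → 𝟙 (q ≤? cnt P? s)) ≤ (n * ∑ xs (λ x → 𝟙 (P? x))) ^ q * length xs ^ n
cnt-tail P? xs n zero = *-monoʳ-≤ 1 (≤-trans (∑-mono (seqs xs n) (λ s → 𝟙≤1 (0 ≤? cnt P? s))) (≤-reflexive (∑-seqs-1 xs n)))
cnt-tail P? xs zero (suc q) = ≤-trans (≤-reflexive (*-zeroʳ (suc q ! * length xs ^ suc q))) z≤n
cnt-tail P? xs (suc n) (suc q) = begin
  suc q ! * e ^ suc q * ∑ (seqs xs (suc n)) (λ s → 𝟙 (suc q ≤? cnt P? s))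
    ≡⟨ cong (suc q ! * e ^ suc q *_) (∑-seqs-suc xs n _) ⟩
  suc q ! * e ^ suc q * ∑ xs (λ x → ∑ (seqs xs n) (λ s → 𝟙 (suc q ≤? (𝟙 (P? x) + cnt P? s))))
    ≤⟨ *-monoʳ-≤ (suc q ! * e ^ suc q) (∑-mono xs perLetter) ⟩
  suc q ! * e ^ suc q * ∑ xs (λ x → #≥ q * 𝟙 (P? x) + #≥ (suc q))
    ≡⟨ cong (suc q ! * e ^ suc q *_) (trans (∑-+ xs _ _) (cong₂ _+_ (∑-* xs (#≥ q) _) (∑-const xs (#≥ (suc q))))) ⟩
  suc q * q ! * (e * e ^ q) * (#≥ q * f + e * #≥ (suc q))
    ≡⟨ regroup (suc q) (q !) e (e ^ q) (#≥ q) f (#≥ (suc q)) ⟩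
  suc q * f * e * (q ! * e ^ q * #≥ q) + e * (suc q * q ! * (e * e ^ q) * #≥ (suc q))
    ≤⟨ +-mono-≤ (*-monoʳ-≤ (suc q * f * e) (cnt-tail P? xs n q)) (*-monoʳ-≤ e (cnt-tail P? xs n (suc q))) ⟩
  suc q * f * e * ((n * f) ^ q * e ^ n) + e * ((n * f) ^ suc q * e ^ n)
    ≡⟨ cong₂ (λ a b → suc q * f * e * (a * e ^ n) + e * (b * e ^ n)) (^-distribʳ-* q n f) (^-distribʳ-* (suc q) n f) ⟩
  suc q * f * e * (n ^ q * f ^ q * e ^ n) + e * (n ^ suc q * f ^ suc q * e ^ n)
    ≡⟨ regroup′ (suc q) f e (n ^ q) (f ^ q) (e ^ n) n ⟩
  (n ^ suc q + suc q * n ^ q) * (f ^ suc q * e ^ suc n)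
    ≤⟨ *-monoˡ-≤ (f ^ suc q * e ^ suc n) (binomial-two-terms n q) ⟩
  suc n ^ suc q * (f ^ suc q * e ^ suc n)
    ≡⟨ *-assoc (suc n ^ suc q) (f ^ suc q) (e ^ suc n) ⟨
  suc n ^ suc q * f ^ suc q * e ^ suc n
    ≡⟨ cong (_* e ^ suc n) (^-distribʳ-* (suc q) (suc n) f) ⟨
  (suc n * f) ^ suc q * e ^ suc n ∎
  where
  open ≤-Reasoning
  e = length xs
  f = ∑ xs (λ x → 𝟙 (P? x))
  #≥ : ℕ → ℕ
  #≥ k = ∑ (seqs xs n) (λ s → 𝟙 (k ≤? cnt P? s))
  perLetter : ∀ x → ∑ (seqs xs n) (λ s → 𝟙 (suc q ≤? (𝟙 (P? x) + cnt P? s))) ≤ #≥ q * 𝟙 (P? x) + #≥ (suc q)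
  perLetter x with P? x
  ... | no _ = m≤n+m _ (#≥ q * 0)
  -- After a hit, q more are needed. The second summand is kept here as well, so that both cases
  -- follow the recursion of `binomial-two-terms`.
  ... | yes _ = ≤-trans (∑-mono (seqs xs n) (λ s → 𝟙-mono (suc q ≤? suc (cnt P? s)) (q ≤? cnt P? s) s≤s⁻¹))
                  (≤-trans (≤-reflexive (sym (*-identityʳ (#≥ q)))) (m≤m+n _ _))
  regroup : ∀ s g e e′ N f N′ → s * g * (e * e′) * (N * f + e * N′) ≡ s * f * e * (g * e′ * N) + e * (s * g * (e * e′) * N′)
  regroup = solve-∀
  regroup′ : ∀ s f e a b c n → s * f * e * (a * b * c) + e * (n * a * (f * b) * c) ≡ (n * a + s * a) * (f * b * (e * c))
  regroup′ = solve-∀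

length-allFin : ∀ n → length (allFin n) ≡ n
length-allFin n = length-tabulate id

length-cartesianProduct : ∀ (xs : List A) (ys : List B) → length (cartesianProduct xs ys) ≡ length xs * length ys
length-cartesianProduct [] ys = refl
length-cartesianProduct (x ∷ xs) ys = trans (length-++ (map (x ,_) ys))
  (cong₂ _+_ (length-map (x ,_) ys) (length-cartesianProduct xs ys))

∑-cartesianProduct : ∀ (xs : List A) (ys : List B) f →
  ∑ (cartesianProduct xs ys) f ≡ ∑ xs (λ x → ∑ ys (λ y → f (x , y)))
∑-cartesianProduct [] ys f = refl
∑-cartesianProduct (x ∷ xs) ys f = trans (∑-++ (map (x ,_) ys) _ f)
  (cong₂ _+_ (∑-map (x ,_) ys f) (∑-cartesianProduct xs ys f))

-- Turns the edge sequence and the separately drawn tie bits into one i.i.d. sequence of (edge, bit)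
-- pairs, to which the window bounds apply.
∑-zip : ∀ (xs : List A) (ys : List B) n f →
  ∑ (seqs xs n) (λ s → ∑ (seqs ys n) (λ t → f (zip s t))) ≡ ∑ (seqs (cartesianProduct xs ys) n) f
∑-zip xs ys zero f = +-identityʳ _
∑-zip xs ys (suc n) f = begin
  ∑ (seqs xs (suc n)) (λ s → ∑ (seqs ys (suc n)) (λ t → f (zip s t)))
    ≡⟨ ∑-seqs-suc xs n _ ⟩
  ∑ xs (λ x → ∑ (seqs xs n) (λ s → ∑ (seqs ys (suc n)) (λ t → f (zip (x ∷ s) t))))
    ≡⟨ ∑-cong xs (λ x → trans (∑-cong (seqs xs n) (λ s → ∑-seqs-suc ys n _))
         (trans (∑-swap (seqs xs n) ys _) (∑-cong ys (λ y → ∑-zip xs ys n _)))) ⟩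
  ∑ xs (λ x → ∑ ys (λ y → ∑ (seqs (cartesianProduct xs ys) n) (λ s → f ((x , y) ∷ s))))
    ≡⟨ ∑-cartesianProduct xs ys _ ⟨
  ∑ (cartesianProduct xs ys) (λ z → ∑ (seqs (cartesianProduct xs ys) n) (λ s → f (z ∷ s)))
    ≡⟨ ∑-seqs-suc (cartesianProduct xs ys) n f ⟨
  ∑ (seqs (cartesianProduct xs ys) (suc n)) f ∎
  where open ≡-Reasoning

-- A window that overhangs the end of the vector counts only the positions that exist.
window : ∀ {P : A → Set} → Decidable P → (start len : ℕ) → Vec A n → ℕ
window P? zero zero xs = 0
window P? zero (suc τ) [] = 0
window P? zero (suc τ) (x ∷ xs) = 𝟙 (P? x) + window P? zero τ xs
window P? (suc a) τ [] = 0
window P? (suc a) τ (x ∷ xs) = window P? a τ xs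

-- Exponential Markov inequality, with weight 1 on hits and 2 on misses.
window-tail₀ : ∀ {P : A → Set} (P? : Decidable P) (xs : List A) τ r h →
  2 ^ τ * ∑ (seqs xs (τ + r)) (λ s → 𝟙 (window P? 0 τ s <? h))
    ≤ ∑ xs (λ x → 2 ∸ 𝟙 (P? x)) ^ τ * (2 ^ h * length xs ^ r)
window-tail₀ P? xs zero r h = *-monoʳ-≤ 1 (begin
  ∑ (seqs xs r) (λ s → 𝟙 (0 <? h))      ≤⟨ ∑-mono (seqs xs r) (λ _ → 𝟙≤1 (0 <? h)) ⟩
  ∑ (seqs xs r) (λ _ → 1)               ≡⟨ ∑-seqs-1 xs r ⟩
  length xs ^ r                         ≡⟨ *-identityˡ _ ⟨
  1 * length xs ^ r                     ≤⟨ *-monoˡ-≤ (length xs ^ r) (1≤^ 2 h (s≤s z≤n)) ⟩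
  2 ^ h * length xs ^ r                 ∎)
  where open ≤-Reasoning
window-tail₀ {A = A} P? xs (suc τ) r h = begin
  2 ^ suc τ * ∑ (seqs xs (suc τ + r)) (λ s → 𝟙 (window P? 0 (suc τ) s <? h))
    ≡⟨ cong (2 ^ suc τ *_) (∑-seqs-suc xs (τ + r) _) ⟩
  2 ^ suc τ * ∑ xs (λ x → ∑ (seqs xs (τ + r)) (λ s → 𝟙 ((𝟙 (P? x) + window P? 0 τ s) <? h)))
    ≡⟨ ∑-* xs (2 ^ suc τ) _ ⟨
  ∑ xs (λ x → 2 ^ suc τ * ∑ (seqs xs (τ + r)) (λ s → 𝟙 ((𝟙 (P? x) + window P? 0 τ s) <? h)))
    ≤⟨ ∑-mono xs (perLetter h) ⟩
  ∑ xs (λ x → bound h * (2 ∸ 𝟙 (P? x)))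
    ≡⟨ ∑-* xs (bound h) _ ⟩
  bound h * g
    ≡⟨ regroup (g ^ τ) (2 ^ h * length xs ^ r) g ⟩
  g ^ suc τ * (2 ^ h * length xs ^ r) ∎
  where
  open ≤-Reasoning
  g = ∑ xs (λ x → 2 ∸ 𝟙 (P? x))
  bound : ℕ → ℕ
  bound h = g ^ τ * (2 ^ h * length xs ^ r)
  regroup : ∀ a b g → a * b * g ≡ g * a * b
  regroup = solve-∀
  swap₂ : ∀ a b c → a * (2 * b * c) ≡ 2 * (a * (b * c))
  swap₂ = solve-∀
  perLetter : ∀ h x → 2 ^ suc τ * ∑ (seqs xs (τ + r)) (λ s → 𝟙 ((𝟙 (P? x) + window P? 0 τ s) <? h)) ≤ bound h * (2 ∸ 𝟙 (P? x))
  perLetter h x with P? x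
  ... | no _ = begin
    2 * 2 ^ τ * ∑ (seqs xs (τ + r)) (λ s → 𝟙 (window P? 0 τ s <? h))     ≡⟨ *-assoc 2 (2 ^ τ) _ ⟩
    2 * (2 ^ τ * ∑ (seqs xs (τ + r)) (λ s → 𝟙 (window P? 0 τ s <? h)))   ≤⟨ *-monoʳ-≤ 2 (window-tail₀ P? xs τ r h) ⟩
    2 * bound h                                                              ≡⟨ *-comm 2 (bound h) ⟩
    bound h * 2 ∎
  -- No count is below 0, so nothing is left to bound.
  perLetter zero x | yes _ = ≤-trans (≤-reflexive (trans (cong (2 ^ suc τ *_)
    (n≤0⇒n≡0 (≤-trans (∑-≤const (seqs xs (τ + r)) 0 (λ {s} _ → ≤-reflexive (𝟙-no (suc (window P? 0 τ s) <? 0) λ ())))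
      (≤-reflexive (*-zeroʳ (length (seqs xs (τ + r)))))))) (*-zeroʳ (2 ^ suc τ)))) z≤n
  -- A hit weighs 1 instead of 2; the missing factor comes from 2^h, as the remaining threshold
  -- drops by one.
  perLetter (suc h) x | yes _ = begin
    2 * 2 ^ τ * ∑ (seqs xs (τ + r)) (λ s → 𝟙 (suc (window P? 0 τ s) <? suc h))
      ≤⟨ *-monoʳ-≤ (2 * 2 ^ τ) (∑-mono (seqs xs (τ + r)) (λ s → 𝟙-mono (suc (window P? 0 τ s) <? suc h) (window P? 0 τ s <? h) s≤s⁻¹)) ⟩
    2 * 2 ^ τ * ∑ (seqs xs (τ + r)) (λ s → 𝟙 (window P? 0 τ s <? h))     ≡⟨ *-assoc 2 (2 ^ τ) _ ⟩
    2 * (2 ^ τ * ∑ (seqs xs (τ + r)) (λ s → 𝟙 (window P? 0 τ s <? h)))   ≤⟨ *-monoʳ-≤ 2 (window-tail₀ P? xs τ r h) ⟩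
    2 * bound h                                                              ≡⟨ swap₂ (g ^ τ) (2 ^ h) (length xs ^ r) ⟨
    bound (suc h)                                                            ≡⟨ *-identityʳ _ ⟨
    bound (suc h) * 1 ∎

-- Letters before the window are unconstrained, and each contributes a factor |xs|.
window-tail : ∀ {P : A → Set} (P? : Decidable P) (xs : List A) a τ r h →
  2 ^ τ * ∑ (seqs xs (a + (τ + r))) (λ s → 𝟙 (window P? a τ s <? h))
    ≤ ∑ xs (λ x → 2 ∸ 𝟙 (P? x)) ^ τ * (2 ^ h * length xs ^ (a + r))
window-tail P? xs zero τ r h = window-tail₀ P? xs τ r h
window-tail P? xs (suc a) τ r h = begin
  2 ^ τ * ∑ (seqs xs (suc a + (τ + r))) (λ s → 𝟙 (window P? (suc a) τ s <? h))
    ≡⟨ cong (2 ^ τ *_) (trans (∑-seqs-suc xs (a + (τ + r)) _) (∑-const xs _)) ⟩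
  2 ^ τ * (length xs * ∑ (seqs xs (a + (τ + r))) (λ s → 𝟙 (window P? a τ s <? h)))
    ≡⟨ regroup (2 ^ τ) (length xs) _ ⟩
  length xs * (2 ^ τ * ∑ (seqs xs (a + (τ + r))) (λ s → 𝟙 (window P? a τ s <? h)))
    ≤⟨ *-monoʳ-≤ (length xs) (window-tail P? xs a τ r h) ⟩
  length xs * (g ^ τ * (2 ^ h * length xs ^ (a + r)))
    ≡⟨ regroup′ (length xs) (g ^ τ) (2 ^ h) (length xs ^ (a + r)) ⟩
  g ^ τ * (2 ^ h * length xs ^ (suc a + r)) ∎
  where
  open ≤-Reasoning
  g = ∑ xs (λ x → 2 ∸ 𝟙 (P? x))
  regroup : ∀ a b c → a * (b * c) ≡ b * (a * c)
  regroup = solve-∀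
  regroup′ : ∀ a b c d → a * (b * (c * d)) ≡ b * (c * (a * d))
  regroup′ = solve-∀

-- Orientations and the offline optimum

target : (Fin N × Fin N → Bool) → Fin N × Fin N → Fin N
target o e = if o e then proj₁ e else proj₂ e

Touches : Fin N → Fin N × Fin N → Set
Touches v e = v ≡ proj₁ e ⊎ v ≡ proj₂ e

touches? : (v : Fin N) → Decidable (Touches v)
touches? v e = (v F.≟ proj₁ e) ⊎-dec (v F.≟ proj₂ e)

Inside : List (Fin N) → Fin N × Fin N → Set
Inside U e = proj₁ e ∈ U × proj₂ e ∈ U

module _ {N : ℕ} where
  open import Data.List.Membership.DecPropositional (F._≟_ {N}) using (_∈?_) public

inside? : (U : List (Fin N)) → Decidable (Inside U)
inside? U e = (proj₁ e ∈? U) ×-dec (proj₂ e ∈? U)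

∑-touches≤2 : ∀ {U : List (Fin N)} → Unique U → ∀ e → ∑ U (λ v → 𝟙 (touches? v e)) ≤ 2
∑-touches≤2 {U = U} u (x , y) = begin
  ∑ U (λ v → 𝟙 (touches? v (x , y)))                           ≤⟨ ∑-mono U pointwise ⟩
  ∑ U (λ v → 𝟙 (x F.≟ v) + 𝟙 (y F.≟ v))                        ≡⟨ ∑-+ U _ _ ⟩
  ∑ U (λ v → 𝟙 (x F.≟ v)) + ∑ U (λ v → 𝟙 (y F.≟ v))            ≤⟨ +-mono-≤ (Unique⇒∑≟≤1 F._≟_ u x) (Unique⇒∑≟≤1 F._≟_ u y) ⟩
  2 ∎
  where
  open ≤-Reasoning
  pointwise : ∀ v → 𝟙 (touches? v (x , y)) ≤ 𝟙 (x F.≟ v) + 𝟙 (y F.≟ v)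
  pointwise v with touches? v (x , y)
  ... | no _ = z≤n
  ... | yes (inj₁ eq) = ≤-trans (≤-reflexive (sym (𝟙-yes (x F.≟ v) (sym eq)))) (m≤m+n _ _)
  ... | yes (inj₂ eq) = ≤-trans (≤-reflexive (sym (𝟙-yes (y F.≟ v) (sym eq)))) (m≤n+m _ (𝟙 (x F.≟ v)))

handshake : ∀ {U : List (Fin N)} → Unique U → ∀ {P : Fin N × Fin N → Set} (P? : Decidable P) (s : Vec (Fin N × Fin N) n) →
  ∑ U (λ v → cnt (λ e → P? e ×-dec touches? v e) s) ≤ 2 * cnt P? s
handshake {U = U} u P? [] = ≤-reflexive (trans (∑-const U 0) (*-zeroʳ (length U)))
handshake {U = U} u P? (e ∷ s) = begin
  ∑ U (λ v → 𝟙 (P? e ×-dec touches? v e) + cnt (λ e → P? e ×-dec touches? v e) s)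
    ≡⟨ ∑-+ U _ _ ⟩
  ∑ U (λ v → 𝟙 (P? e ×-dec touches? v e)) + ∑ U (λ v → cnt (λ e → P? e ×-dec touches? v e) s)
    ≤⟨ +-mono-≤ head (handshake u P? s) ⟩
  2 * 𝟙 (P? e) + 2 * cnt P? s
    ≡⟨ *-distribˡ-+ 2 (𝟙 (P? e)) (cnt P? s) ⟨
  2 * (𝟙 (P? e) + cnt P? s) ∎
  where
  open ≤-Reasoning
  head : ∑ U (λ v → 𝟙 (P? e ×-dec touches? v e)) ≤ 2 * 𝟙 (P? e)
  head with P? e
  ... | yes p = ≤-trans (∑-mono U (λ v → 𝟙-mono (yes p ×-dec touches? v e) (touches? v e) proj₂)) (∑-touches≤2 u e)
  ... | no ¬p = ≤-trans (∑-≤const U 0 (λ _ → z≤n)) (≤-reflexive (*-zeroʳ (length U)))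

-- Peeling: a sparse edge set has a vertex of degree < 2κ; orient all its edges towards it and delete it.
peel : ∀ {P : Fin N × Fin N → Set} (P? : Decidable P) (s : Vec (Fin N × Fin N) n) κ fuel (U : List (Fin N)) →
  length U ≤ fuel → Unique U →
  (∀ W → W ⊆ U → 1 ≤ length W → cnt (λ e → P? e ×-dec inside? W e) s < κ * length W) →
  ∃ λ o → ∀ v → cnt (λ e → (P? e ×-dec inside? U e) ×-dec (target o e F.≟ v)) s ≤ 2 * κ
peel P? s κ fuel [] _ _ _ = (λ _ → true) , λ v → ≤-trans (none v s) z≤n
  where
  none : ∀ {n} v (s : Vec _ n) → cnt (λ e → (P? e ×-dec inside? [] e) ×-dec (target (λ _ → true) e F.≟ v)) s ≤ 0
  none v [] = z≤n
  none v (e ∷ s) = +-mono-≤ (≤-reflexive (𝟙-no ((P? e ×-dec inside? [] e) ×-dec _) λ { ((_ , () , _) , _) })) (none v s)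
peel {N = N} {P = P} P? s κ (suc fuel) U@(_ ∷ _) (s≤s le) u sparse with ∑<⇒∃< U deg (2 * κ) total
  where
  deg : Fin N → ℕ
  deg v = cnt (λ e → (P? e ×-dec inside? U e) ×-dec touches? v e) s
  -- Sparsity of `U` itself bounds the average degree; sparsity of its subsets serves the recursion.
  total : ∑ U deg < 2 * κ * length U
  total = ≤-<-trans (handshake u (λ e → P? e ×-dec inside? U e) s)
    (subst (2 * cnt (λ e → P? e ×-dec inside? U e) s <_) (sym (*-assoc 2 κ (length U)))
      (*-monoʳ-< 2 (sparse U ⊆-refl (s≤s z≤n))))
... | v , v∈ , deg<2κ = o , load
  where
  W = filter (λ w → ¬? (w F.≟ v)) U
  W⊆U : W ⊆ U
  W⊆U = filter-⊆ (λ w → ¬? (w F.≟ v)) U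
  |W|≤ : length W ≤ fuel
  |W|≤ = ≤-trans (s≤s⁻¹ (filter-notAll (λ w → ¬? (w F.≟ v)) U (lose v∈ (λ ¬eq → ¬eq refl)))) le
  rec = peel P? s κ fuel W |W|≤ (Unique-resp-⊆ W⊆U u) (λ X X⊆W → sparse X (⊆-trans X⊆W W⊆U))
  o′ = proj₁ rec
  o : Fin N × Fin N → Bool
  o e = if ⌊ v F.≟ proj₁ e ⌋ then true else (if ⌊ v F.≟ proj₂ e ⌋ then false else o′ e)
  target-cases : ∀ e → target o e ≡ v ⊎ (v ≢ proj₁ e × v ≢ proj₂ e × target o e ≡ target o′ e)
  target-cases e with v F.≟ proj₁ e
  ... | yes eq = inj₁ (sym eq)
  ... | no ≢₁ with v F.≟ proj₂ e
  ... | yes eq = inj₁ (sym eq)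
  ... | no ≢₂ = inj₂ (≢₁ , ≢₂ , refl)
  target-touches : ∀ e → Touches (target o e) e
  target-touches e with o e
  ... | true = inj₁ refl
  ... | false = inj₂ refl
  load : ∀ w → cnt (λ e → (P? e ×-dec inside? U e) ×-dec (target o e F.≟ w)) s ≤ 2 * κ
  load w with w F.≟ v
  ... | yes refl = ≤-trans (cnt-mono _ _ s λ {e} (pe , eq) → pe , subst (λ z → Touches z e) eq (target-touches e)) (<⇒≤ deg<2κ)
  -- An edge sent to w ≠ v avoids v altogether, so it lies inside `W` and keeps its recursive
  -- orientation.
  ... | no w≢v = ≤-trans (cnt-mono _ _ s to-W) (proj₂ rec w)
    where
    to-W : ∀ {e} → (P e × Inside U e) × target o e ≡ w → (P e × Inside W e) × target o′ e ≡ w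
    to-W {e} ((p , ∈₁ , ∈₂) , eq) with target-cases e
    ... | inj₁ eq′ = ⊥-elim (w≢v (trans (sym eq) eq′))
    ... | inj₂ (≢₁ , ≢₂ , eq′) =
      (p , ∈-filter⁺ (λ w → ¬? (w F.≟ v)) ∈₁ (≢₁ ∘ sym) , ∈-filter⁺ (λ w → ¬? (w F.≟ v)) ∈₂ (≢₂ ∘ sym)) , trans (sym eq′) eq

maxVec-lub : ∀ {k} (xs : Vec ℕ k) {b} → (∀ i → lookup xs i ≤ b) → maxVec xs ≤ b
maxVec-lub [] le = z≤n
maxVec-lub (x ∷ xs) le = ⊔-lub (le zero) (maxVec-lub xs (le ∘ suc))

lookup≤maxVec : ∀ {k} (xs : Vec ℕ k) i → lookup xs i ≤ maxVec xs
lookup≤maxVec (x ∷ xs) zero = m≤m⊔n x _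
lookup≤maxVec (x ∷ xs) (suc i) = ≤-trans (lookup≤maxVec xs i) (m≤n⊔m x _)

foldr-⊓≤ : ∀ b {x} xs → x ∈ xs → foldr _⊓_ b xs ≤ x
foldr-⊓≤ b (x ∷ xs) (here refl) = m⊓n≤m x _
foldr-⊓≤ b (x ∷ xs) (there y∈) = ≤-trans (m⊓n≤n x _) (foldr-⊓≤ b xs y∈)

∈-allBoolVecs : ∀ {n} (bs : Vec Bool n) → bs ∈ allBoolVecs n
∈-allBoolVecs [] = here refl
∈-allBoolVecs {suc n} (true ∷ bs) = ∈-++⁺ˡ (∈-map⁺ (true ∷_) (∈-allBoolVecs bs))
∈-allBoolVecs {suc n} (false ∷ bs) =
  ∈-++⁺ʳ (map (true ∷_) (allBoolVecs n)) (∈-++⁺ˡ (∈-map⁺ (false ∷_) (∈-allBoolVecs bs)))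

lookup-updateAt-suc : ∀ {k} (xs : Vec ℕ k) t v → lookup (updateAt xs t suc) v ≡ 𝟙 (t F.≟ v) + lookup xs v
lookup-updateAt-suc xs t v with t F.≟ v
... | yes refl = lookup∘updateAt t xs
... | no t≢v = lookup∘updateAt′ v t (t≢v ∘ sym) xs

module _ (G : Graph) where

  lookup-loads : ∀ {n} (o : Edge G → Bool) (s : Vec (Edge G) n) v →
    lookup (loads G s (Vec.map o s)) v ≡ cnt (λ e → target o e F.≟ v) s
  lookup-loads o [] v = lookup-replicate v 0
  lookup-loads o (e ∷ s) v = trans (lookup-updateAt-suc (loads G s (Vec.map o s)) (target o e) v)
    (cong (𝟙 (target o e F.≟ v) +_) (lookup-loads o s v))

  -- Here the orientation depends on the edge rather than on the arrival, so copies of an edge all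
  -- go the same way. This suffices because `cnt`, and with it sparsity, counts copies.
  opt≤orientation : ∀ {n} (o : Edge G → Bool) (s : Vec (Edge G) n) k →
    (∀ v → cnt (λ e → target o e F.≟ v) s ≤ k) → opt G s ≤ k
  opt≤orientation o s k le = ≤-trans
    (foldr-⊓≤ _ _ (∈-map⁺ (λ bs → maxVec (loads G s bs)) (∈-allBoolVecs (Vec.map o s))))
    (maxVec-lub (loads G s (Vec.map o s)) λ v → ≤-trans (≤-reflexive (lookup-loads o s v)) (le v))

  opt≤T : ∀ {n} (s : Vec (Edge G) n) → opt G s ≤ n
  opt≤T s = opt≤orientation (λ _ → true) s _ (λ v → cnt≤n _ s)

-- The greedy algorithm

module _ (G : Graph) where

  greedyStep-mono : ∀ ld e b v → lookup ld v ≤ lookup (greedyStep G ld e b) v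
  greedyStep-mono ld e b v = ≤-trans (m≤n+m _ _) (≤-reflexive (sym (lookup-updateAt-suc ld _ v)))

  greedyRun-mono : ∀ {n} (s : Vec (Edge G) n) bs ld v → lookup ld v ≤ lookup (greedyRun G ld s bs) v
  greedyRun-mono [] [] ld v = ≤-refl
  greedyRun-mono (e ∷ s) (b ∷ bs) ld v = ≤-trans (greedyStep-mono ld e b v) (greedyRun-mono s bs _ v)

  -- Either `u` is strictly lighter, or the bit `true` settles the tie for it. In the base graph the
  -- first endpoint is the one in the parent node.
  greedyStep-towards-first : ∀ ld u w → lookup ld u ≤ lookup ld w →
    suc (lookup ld u) ≤ lookup (greedyStep G ld (u , w) true) u
  greedyStep-towards-first ld u w le with lookup ld u <ᵇ lookup ld w
  ... | true = ≤-reflexive (sym (trans (lookup-updateAt-suc ld u u) (cong (_+ lookup ld u) (𝟙-yes (u F.≟ u) refl))))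
  ... | false with lookup ld w <ᵇ lookup ld u in eq
  ...   | true = ⊥-elim (<⇒≱ (<ᵇ⇒< _ _ (subst T (sym eq) _)) le)
  ...   | false = ≤-reflexive (sym (trans (lookup-updateAt-suc ld u u) (cong (_+ lookup ld u) (𝟙-yes (u F.≟ u) refl))))

  module Phases (node : Fin (nV G) → ℕ) (R : ℕ) where

    -- Independent of the loads by design. The children of node a are R a + 1, ..., R a + R; only
    -- the upper end is recorded, since the invariant concerns initial segments of nodes.
    Helps : Fin (nV G) → Edge G × Bool → Set
    Helps v (e , b) = v ≡ proj₁ e × b ≡ true × node (proj₂ e) ≤ R * node (proj₁ e) + R

    helps? : ∀ v → Decidable (Helps v)
    helps? v (e , b) = (v F.≟ proj₁ e) ×-dec (b Bool.≟ true) ×-dec (node (proj₂ e) ≤? R * node (proj₁ e) + R)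

    -- Phase i+1 is in progress, with σ steps left and g full phases to follow.
    greedyRun-phases : ∀ {n} (s : Vec (Edge G) n) bs τ h ld i g σ →
      (∀ v → node v < suc R ^ suc g → i ≤ lookup ld v) →
      (∀ v → node v < suc R ^ g → suc i ≤ lookup ld v + window (helps? v) 0 σ (zip s bs)) →
      (∀ v → node v < suc R ^ g → ∀ k → k < g → h ≤ window (helps? v) (σ + k * τ) τ (zip s bs)) →
      suc i + g ≤ h →
      ∀ v → node v < 1 → suc i + g ≤ lookup (greedyRun G ld s bs) v
    greedyRun-phases s bs τ h ld i zero zero low cur fut le v nv =
      ≤-trans (≤-reflexive (+-identityʳ (suc i)))
        (≤-trans (cur v nv) (≤-trans (≤-reflexive (+-identityʳ _)) (greedyRun-mono s bs ld v)))
    greedyRun-phases s bs τ h ld i (suc g) zero low cur fut le v nv =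
      subst (_≤ lookup (greedyRun G ld s bs) v) (sym (+-suc (suc i) g))
        (greedyRun-phases s bs τ h ld (suc i) g τ
          (λ w nw → ≤-trans (cur w nw) (≤-reflexive (+-identityʳ _)))
          -- When a phase starts, the hits of its full window, at least h ≥ i + 2, give the bound by
          -- themselves.
          (λ w nw → ≤-trans (≤-trans ssi≤h (fut w (wider w nw) 0 (s≤s z≤n))) (m≤n+m _ _))
          (λ w nw k k<g → fut w (wider w nw) (suc k) (s≤s k<g))
          (subst (_≤ h) (+-suc (suc i) g) le) v nv)
      where
      wider : ∀ w → node w < suc R ^ g → node w < suc R ^ suc g
      wider w nw = ≤-trans nw (m≤m+n _ _)
      ssi≤h : suc (suc i) ≤ h
      ssi≤h = ≤-trans (≤-trans (m≤m+n _ g) (≤-reflexive (sym (+-suc (suc i) g)))) le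
    greedyRun-phases [] [] τ h ld i zero (suc σ) low cur fut le v nv =
      ≤-trans (≤-reflexive (+-identityʳ (suc i))) (≤-trans (cur v nv) (≤-reflexive (+-identityʳ _)))
    greedyRun-phases [] [] τ h ld i (suc g) (suc σ) low cur fut le v nv =
      -- Arrivals cannot run out while a further phase is due: `fut` would place h ≥ 1 hits in an
      -- empty sequence.
      ⊥-elim (n≮0 (≤-trans (s≤s z≤n) (≤-trans le (fut v (≤-trans nv (1≤^ (suc R) (suc g) (s≤s z≤n))) 0 (s≤s z≤n)))))
    greedyRun-phases (e ∷ s) (b ∷ bs) τ h ld i g (suc σ) low cur fut le =
      greedyRun-phases s bs τ h ld′ i g σ
        (λ w nw → ≤-trans (low w nw) (greedyStep-mono ld e b w)) cur′ fut le
      where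
      ld′ = greedyStep G ld e b
      -- Powers of R + 1 replace the exact level boundaries of the heap: they grow fast enough to be
      -- closed under taking children, without geometric sums.
      child< : ∀ {a c} → a < suc R ^ g → c ≤ R * a + R → c < suc R ^ suc g
      child< {a} {c} a< c≤ = begin-strict
        c                           ≤⟨ c≤ ⟩
        R * a + R                   ≡⟨ trans (+-comm (R * a) R) (sym (*-suc R a)) ⟩
        R * suc a                   ≤⟨ *-monoʳ-≤ R a< ⟩
        R * suc R ^ g               <⟨ m<n+m _ (1≤^ (suc R) g (s≤s z≤n)) ⟩
        suc R ^ g + R * suc R ^ g   ∎
        where open ≤-Reasoning
      -- Load plus hits still due in this phase is a potential. A helpful arrival uses up one hit
      -- but raises a load that is at most i; a load above i meets the bound alone.
      cur′ : ∀ w → node w < suc R ^ g → suc i ≤ lookup ld′ w + window (helps? w) 0 σ (zip s bs)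
      cur′ w nw with helps? w (e , b) | cur w nw
      ... | no _ | c = ≤-trans c (+-monoˡ-≤ _ (greedyStep-mono ld e b w))
      ... | yes (refl , refl , child) | c with lookup ld (proj₁ e) ≤? i
      ...   | yes ≤i = ≤-trans c (≤-trans (≤-reflexive (+-suc _ _))
                (+-monoˡ-≤ _ (greedyStep-towards-first ld (proj₁ e) (proj₂ e)
                  (≤-trans ≤i (low (proj₂ e) (child< nw child))))))
      ...   | no ≰i = ≤-trans (≰⇒> ≰i) (≤-trans (greedyStep-mono ld e b w) (m≤m+n _ _))

-- The base graph

-- The R-ary heap on the nodes 0, …, J R (node c + 1 has parent c / R, so exactly the nodes below J have children,
-- R each), with every node blown up to J R independent vertices.
module BlownUpHeap (J R : ℕ) .{{_ : NonZero J}} .{{_ : NonZero R}} where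

  -- Being both the number of non-root nodes and the size of each node, m ≈ √n yields about n
  -- vertices and exactly m³ edges.
  m : ℕ
  m = J * R

  1≤J : 1 ≤ J
  1≤J = >-nonZero⁻¹ J

  1≤R : 1 ≤ R
  1≤R = >-nonZero⁻¹ R

  1≤m : 1 ≤ m
  1≤m = *-mono-≤ 1≤J 1≤R

  J≤1+m : J ≤ suc m
  J≤1+m = m≤n⇒m≤1+n (m≤m*n J R)

  internal : Fin J → Fin (suc m)
  internal j = inject≤ j J≤1+m

  child : Fin J → Fin R → Fin (suc m)
  child j r = suc (combine j r)

  parent : Fin m → Fin (suc m)
  parent c = internal (proj₁ (remQuot {J} R c))

  vertex : Fin (suc m) → Fin m → Fin (suc m * m)
  vertex = combine

  -- The parent's vertex comes first. This makes the bit `true` favour the parent, and `parent≤`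
  -- then gives `ordered`.
  edge : Fin m × (Fin m × Fin m) → Fin (suc m * m) × Fin (suc m * m)
  edge (c , x , y) = vertex (parent c) x , vertex (suc c) y

  parent≤ : ∀ c → toℕ (parent c) ≤ toℕ c
  parent≤ c = begin
    toℕ (parent c)                    ≡⟨ toℕ-inject≤ j J≤1+m ⟩
    toℕ j                             ≤⟨ m≤n*m (toℕ j) R ⟩
    R * toℕ j                         ≤⟨ m≤m+n _ (toℕ r) ⟩
    R * toℕ j + toℕ r                 ≡⟨ toℕ-combine j r ⟨
    toℕ (combine j r)                 ≡⟨ cong toℕ (combine-remQuot {J} R c) ⟩
    toℕ c                             ∎
    where
    open ≤-Reasoning
    j = proj₁ (remQuot {J} R c)
    r = proj₂ (remQuot {J} R c)

  edge-injective : ∀ {t t′} → edge t ≡ edge t′ → t ≡ t′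
  edge-injective {c , x , y} {c′ , x′ , y′} eq
    with combine-injective (parent c) x (parent c′) x′ (,-injectiveˡ eq)
       | combine-injective (suc c) y (suc c′) y′ (,-injectiveʳ eq)
  ... | _ , refl | refl , refl = refl

  indices : List (Fin m × (Fin m × Fin m))
  indices = cartesianProduct (allFin m) (cartesianProduct (allFin m) (allFin m))

  graph : Graph
  graph = record
    { nV = suc m * m
    ; edges = map edge indices
    ; ordered = Allₚ.map⁺ (All.universal (λ { (c , x , y) → combine-monoˡ-< x y (s≤s (parent≤ c)) }) indices)
    ; unique = Uniqueₚ.map⁺ edge-injective
        (Uniqueₚ.cartesianProduct⁺ (Uniqueₚ.allFin⁺ m) (Uniqueₚ.cartesianProduct⁺ (Uniqueₚ.allFin⁺ m) (Uniqueₚ.allFin⁺ m)))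
    }

  E : List (Edge graph)
  E = edges graph

  V : Set
  V = Fin (nV graph)

  length-edges : length E ≡ m * (m * m)
  length-edges = trans (length-map edge indices)
    (trans (length-cartesianProduct (allFin m) _)
      (cong₂ _*_ (length-allFin m) (trans (length-cartesianProduct (allFin m) (allFin m)) (cong₂ _*_ (length-allFin m) (length-allFin m)))))

  edge∈E : ∀ t → edge t ∈ E
  edge∈E (c , x , y) = ∈-map⁺ edge (∈-cartesianProduct⁺ (∈-allFin c) (∈-cartesianProduct⁺ (∈-allFin x) (∈-allFin y)))

  ∈E⁻ : ∀ {e} → e ∈ E → ∃ λ t → e ≡ edge t
  ∈E⁻ e∈ with ∈-map⁻ edge e∈
  ... | t , _ , eq = t , eq

  node : V → Fin (suc m)
  node v = proj₁ (remQuot {suc m} m v)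

  node-vertex : ∀ a x → node (vertex a x) ≡ a
  node-vertex a x = cong proj₁ (remQuot-combine a x)

  vertex-node : ∀ v → ∃ λ x → v ≡ vertex (node v) x
  vertex-node v = proj₂ (remQuot {suc m} m v) , sym (combine-remQuot {suc m} m v)

  parentOf : Fin (suc m) → Fin (suc m)
  parentOf zero = zero
  parentOf (suc c) = parent c

  -- Left inverse of internal (junk value 0 on the leaves).
  starAt : Fin (suc m) → Fin J
  starAt a with toℕ a <? J
  ... | yes a<J = fromℕ< a<J
  ... | no _ = fromℕ< 1≤J

  starAt-internal : ∀ j → starAt (internal j) ≡ j
  starAt-internal j with toℕ (internal j) <? J
  ... | yes lt = toℕ-injective (trans (toℕ-fromℕ< lt) (toℕ-inject≤ j J≤1+m))
  ... | no ≮ = ⊥-elim (≮ (subst (_< J) (sym (toℕ-inject≤ j J≤1+m)) (toℕ<n j)))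

  internal⁻ : ∀ a → toℕ a < J → ∃ λ j → a ≡ internal j
  internal⁻ a a<J = fromℕ< a<J , toℕ-injective (sym (trans (toℕ-inject≤ (fromℕ< a<J) J≤1+m) (toℕ-fromℕ< a<J)))

  starOf : Edge graph → Fin J
  starOf e = starAt (parentOf (node (proj₂ e)))

  starOf-edge : ∀ c x y → starOf (edge (c , x , y)) ≡ starAt (parent c)
  starOf-edge c x y = cong (starAt ∘ parentOf) (node-vertex (suc c) y)

  starOf-edge′ : ∀ c x y → starOf (edge (c , x , y)) ≡ proj₁ (remQuot {J} R c)
  starOf-edge′ c x y = trans (starOf-edge c x y) (starAt-internal _)

  centre : Fin J → List V
  centre j = map (vertex (internal j)) (allFin m)

  leaves : Fin J → List V
  leaves j = map (λ (r , y) → vertex (child j r) y) (cartesianProduct (allFin R) (allFin m))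

  star : Fin J → List V
  star j = centre j ++ leaves j

  length-centre : ∀ j → length (centre j) ≡ m
  length-centre j = trans (length-map _ (allFin m)) (length-allFin m)

  length-R×m : length (cartesianProduct (allFin R) (allFin m)) ≡ R * m
  length-R×m = trans (length-cartesianProduct (allFin R) (allFin m)) (cong₂ _*_ (length-allFin R) (length-allFin m))

  length-star : ∀ j → length (star j) ≡ suc R * m
  length-star j = trans (length-++ (centre j)) (cong₂ _+_ (length-centre j) (trans (length-map _ (cartesianProduct (allFin R) (allFin m))) length-R×m))

  Unique-R×m : Unique (cartesianProduct (allFin R) (allFin m))
  Unique-R×m = Uniqueₚ.cartesianProduct⁺ (Uniqueₚ.allFin⁺ R) (Uniqueₚ.allFin⁺ m)

  Unique-star : ∀ j → Unique (star j)
  Unique-star j = Uniqueₚ.++⁺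
    (Uniqueₚ.map⁺ (λ {x} {y} eq → proj₂ (combine-injective (internal j) x (internal j) y eq)) (Uniqueₚ.allFin⁺ m))
    (Uniqueₚ.map⁺ leaf-injective Unique-R×m)
    disjoint
    where
    leaf-injective : ∀ {t t′ : Fin R × Fin m} → vertex (child j (proj₁ t)) (proj₂ t) ≡ vertex (child j (proj₁ t′)) (proj₂ t′) → t ≡ t′
    leaf-injective {r , y} {r′ , y′} eq with combine-injective (child j r) y (child j r′) y′ eq
    ... | eq′ , refl with combine-injective j r j r′ (Finₚ.suc-injective eq′)
    ... | _ , refl = refl
    disjoint : ∀ {v} → v ∈ centre j × v ∈ leaves j → _
    disjoint (v∈₁ , v∈₂) with ∈-map⁻ _ v∈₁ | ∈-map⁻ _ v∈₂
    ... | x , _ , refl | (r , y) , _ , eq with combine-injective (internal j) x (child j r) y eq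
    ... | eq′ , _ = <-irrefl (trans (cong toℕ eq″) (cong toℕ eq′)) (s≤s (parent≤ (combine j r)))
      where
      eq″ : parent (combine j r) ≡ internal j
      eq″ = cong (internal ∘ proj₁) (remQuot-combine {J} {R} j r)

  ∈-leaves : ∀ c y → vertex (suc c) y ∈ leaves (proj₁ (remQuot {J} R c))
  ∈-leaves c y = subst (λ d → vertex (suc d) y ∈ leaves j) (combine-remQuot {J} R c)
    (∈-map⁺ (λ (r , y) → vertex (child j r) y) (∈-cartesianProduct⁺ (∈-allFin (proj₂ (remQuot {J} R c))) (∈-allFin y)))
    where j = proj₁ (remQuot {J} R c)

  ∈-centre : ∀ {e j} → e ∈ E → starOf e ≡ j → proj₁ e ∈ centre j
  ∈-centre e∈ refl with ∈E⁻ e∈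
  ... | (c , x , y) , refl = subst (λ j → vertex (parent c) x ∈ centre j) (sym (starOf-edge′ c x y)) (∈-map⁺ _ (∈-allFin x))

  inside-star : ∀ {e j} → e ∈ E → starOf e ≡ j → Inside (star j) e
  inside-star {e} {j} e∈ eq = ∈-++⁺ˡ (∈-centre e∈ eq) , second e∈ eq
    where
    second : ∀ {e j} → e ∈ E → starOf e ≡ j → proj₂ e ∈ star j
    second e∈ refl with ∈E⁻ e∈
    ... | (c , x , y) , refl = subst (λ j → vertex (suc c) y ∈ star j) (sym (starOf-edge′ c x y)) (∈-++⁺ʳ (centre (proj₁ (remQuot {J} R c))) (∈-leaves c y))

  InsideStar : Fin J → List V → Edge graph → Set
  InsideStar j U e = starOf e ≡ j × Inside U e

  insideStar? : ∀ j U → Decidable (InsideStar j U)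
  insideStar? j U e = (starOf e F.≟ j) ×-dec inside? U e

  -- The first endpoint of every edge of the star lies in the centre, of size m. So the edges inside
  -- `U` inject into U × U and also into centre × U; the second bound matters once `U` is larger
  -- than m.
  insideStar≤ : ∀ j U → ∑ E (λ e → 𝟙 (insideStar? j U e)) ≤ length U * (length U ⊓ m)
  insideStar≤ j U = subst (_≤ u * (u ⊓ m)) (length-filter≡∑ (insideStar? j U) E)
    (subst (length inner ≤_) (sym (*-distribˡ-⊓ u u m)) (⊓-glb ≤u*u ≤u*m))
    where
    u = length U
    inner = filter (insideStar? j U) E
    uniq : Unique inner
    uniq = Uniqueₚ.filter⁺ (insideStar? j U) (unique graph)
    ≤u*u : length inner ≤ u * u
    ≤u*u = subst (length inner ≤_) (length-cartesianProduct U U) (Unique⇒length≤ uniq λ e∈ →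
      let (_ , _ , ∈₁ , ∈₂) = ∈-filter⁻ (insideStar? j U) {xs = E} e∈ in ∈-cartesianProduct⁺ ∈₁ ∈₂)
    ≤u*m : length inner ≤ u * m
    ≤u*m = subst (length inner ≤_)
      (trans (length-cartesianProduct (centre j) U) (trans (cong (_* u) (length-centre j)) (*-comm m u)))
      (Unique⇒length≤ uniq λ e∈ →
        let (e∈E , eq , _ , ∈₂) = ∈-filter⁻ (insideStar? j U) {xs = E} e∈ in ∈-cartesianProduct⁺ (∈-centre e∈E eq) ∈₂)

  -- Every vertex lies in at most two stars: the one centred at its node and the one centred at the parent.
  opt-sparse : ∀ {T} (s : Vec (Edge graph) T) κ → VecAll.All (_∈ E) s →
    (∀ j W → W ⊆ star j → 1 ≤ length W → cnt (insideStar? j W) s < κ * length W) →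
    opt graph s ≤ 4 * κ
  opt-sparse s κ s∈ sparse = opt≤orientation graph o s (4 * κ) load
    where
    starOrientation = λ j → peel (λ e → starOf e F.≟ j) s κ (length (star j)) (star j) ≤-refl (Unique-star j) (sparse j)
    o : Edge graph → Bool
    o e = proj₁ (starOrientation (starOf e)) e
    InStar : Fin J → V → Edge graph → Set
    InStar j v e = InsideStar j (star j) e × target (proj₁ (starOrientation j)) e ≡ v
    target-either : ∀ e → target o e ≡ proj₁ e ⊎ target o e ≡ proj₂ e
    target-either e with o e
    ... | true = inj₁ refl
    ... | false = inj₂ refl
    load : ∀ v → cnt (λ e → target o e F.≟ v) s ≤ 4 * κ
    load v = ≤-trans
      (cnt-⊎ {Q = InStar j₁ v} {Q′ = InStar j₂ v} _ _ _ s∈ split)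
      (≤-trans (+-mono-≤ (proj₂ (starOrientation j₁) v) (proj₂ (starOrientation j₂) v)) (≤-reflexive (four κ)))
      where
      four : ∀ k → 2 * k + 2 * k ≡ 4 * k
      four = solve-∀
      j₁ = starAt (node v)
      j₂ = starAt (parentOf (node v))
      inStar : ∀ {e j} → e ∈ E → target o e ≡ v → starOf e ≡ j → InStar j v e
      inStar e∈ eq refl = (refl , inside-star e∈ refl) , eq
      first-star : ∀ {e} → e ∈ E → starOf e ≡ starAt (node (proj₁ e))
      first-star e∈ with ∈E⁻ e∈
      ... | (c , x , y) , refl = trans (starOf-edge c x y) (cong starAt (sym (node-vertex (parent c) x)))
      split : ∀ {e} → e ∈ E → target o e ≡ v → InStar j₁ v e ⊎ InStar j₂ v e
      split {e} e∈ eq with target-either e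
      ... | inj₁ is₁ = inj₁ (inStar e∈ eq (trans (first-star e∈) (cong (starAt ∘ node) (trans (sym is₁) eq))))
      ... | inj₂ is₂ = inj₂ (inStar e∈ eq (cong (starAt ∘ parentOf ∘ node) (trans (sym is₂) eq)))

  incident : V → Edge graph → Bool
  incident v e = ⌊ proj₁ e F.≟ v ⌋ ∨ ⌊ proj₂ e F.≟ v ⌋

  incident⁺ : ∀ v e → proj₁ e ≡ v ⊎ proj₂ e ≡ v → T (incident v e)
  incident⁺ v e (inj₁ eq) = Equivalence.from (T-∨ {⌊ proj₁ e F.≟ v ⌋} {⌊ proj₂ e F.≟ v ⌋}) (inj₁ (fromWitness eq))
  incident⁺ v e (inj₂ eq) = Equivalence.from (T-∨ {⌊ proj₁ e F.≟ v ⌋}) (inj₂ (fromWitness eq))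

  incident⁻ : ∀ v e → T (incident v e) → proj₁ e ≡ v ⊎ proj₂ e ≡ v
  incident⁻ v e t with Equivalence.to (T-∨ {⌊ proj₁ e F.≟ v ⌋}) t
  ... | inj₁ w = inj₁ (toWitness w)
  ... | inj₂ w = inj₂ (toWitness w)

  -- A vertex below the root sees all m vertices of its parent node; a root vertex sees those of one
  -- child node.
  m≤degree : ∀ v → m ≤ degree graph v
  m≤degree v = via (node v) (vertex-node v)
    where
    from-family : ∀ (t : Fin m → Fin m × (Fin m × Fin m)) → (∀ {y y′} → t y ≡ t y′ → y ≡ y′) →
         (∀ y → proj₁ (edge (t y)) ≡ v ⊎ proj₂ (edge (t y)) ≡ v) → m ≤ degree graph v
    from-family t inj touch = subst (_≤ degree graph v) (trans (length-map (edge ∘ t) (allFin m)) (length-allFin m))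
      (Unique⇒length≤ (Uniqueₚ.map⁺ (inj ∘ edge-injective) (Uniqueₚ.allFin⁺ m)) sub)
      where
      sub : ∀ {e} → e ∈ map (edge ∘ t) (allFin m) → e ∈ filterᵇ (incident v) E
      sub e∈ with ∈-map⁻ (edge ∘ t) e∈
      ... | y , _ , refl = ∈-filter⁺ (T? ∘ incident v) (edge∈E (t y)) (incident⁺ v (edge (t y)) (touch y))
    via : ∀ a → (∃ λ x → v ≡ vertex a x) → m ≤ degree graph v
    via (suc c) (x , eq) = from-family (λ y → c , y , x) (λ eq′ → ,-injectiveˡ (,-injectiveʳ eq′)) (λ y → inj₂ (sym eq))
    via zero (x , eq) = from-family (λ y → combine j r , x , y) (λ eq′ → ,-injectiveʳ (,-injectiveʳ eq′))
      (λ y → inj₁ (trans (cong (λ a → vertex a x) root) (sym eq)))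
      where
      j = fromℕ< 1≤J
      r = fromℕ< 1≤R
      root : parent (combine j r) ≡ zero
      root = toℕ-injective (trans (cong (toℕ ∘ internal ∘ proj₁) (remQuot-combine {J} {R} j r))
        (trans (toℕ-inject≤ j J≤1+m) (toℕ-fromℕ< 1≤J)))

  degree≤ : ∀ v → degree graph v ≤ suc R * m
  degree≤ v = subst (degree graph v ≤_) len
    (Unique⇒length≤ (Uniqueₚ.filter⁺ (T? ∘ incident v) (unique graph)) sub)
    where
    -- At the root `ups`, and at heap leaves `downs`, consist of junk pairs; an upper bound
    -- tolerates them.
    downs = map (v ,_) (leaves (starAt (node v)))
    ups = map (λ x → vertex (parentOf (node v)) x , v) (allFin m)
    len : length (ups ++ downs) ≡ suc R * m
    len = trans (length-++ ups) (cong₂ _+_ (trans (length-map _ (allFin m)) (length-allFin m))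
      (trans (length-map (v ,_) (leaves (starAt (node v)))) (trans (length-map _ (cartesianProduct (allFin R) (allFin m))) length-R×m)))
    sub : ∀ {e} → e ∈ filterᵇ (incident v) E → e ∈ ups ++ downs
    sub {e} e∈ with ∈-filter⁻ (T? ∘ incident v) {xs = E} e∈
    ... | e∈E , t with ∈E⁻ e∈E | incident⁻ v e t
    ...   | (c , x , y) , refl | inj₁ refl = ∈-++⁺ʳ ups (∈-map⁺ (v ,_)
              (subst (λ j → vertex (suc c) y ∈ leaves j)
                (sym (trans (cong starAt (node-vertex (parent c) x)) (starAt-internal _))) (∈-leaves c y)))
    ...   | (c , x , y) , refl | inj₂ refl = ∈-++⁺ˡ
              (subst (λ a → (vertex (parent c) x , v) ∈ map (λ x → vertex (parentOf a) x , v) (allFin m)) (sym (node-vertex (suc c) y))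
                (∈-map⁺ (λ x → vertex (parent c) x , v) (∈-allFin x)))

  open Phases graph (toℕ ∘ node) R public

  arrivals : List (Edge graph × Bool)
  arrivals = cartesianProduct E (true ∷ false ∷ [])

  length-arrivals : length arrivals ≡ length E * 2
  length-arrivals = length-cartesianProduct E (true ∷ false ∷ [])

  -- One arrival for each vertex of each child node, with bit `true`. Out of 2m³ equally likely
  -- arrivals this is a share of at least 1/(2 J m).
  helps-many : ∀ j x → R * m ≤ ∑ arrivals (λ z → 𝟙 (helps? (vertex (internal j) x) z))
  helps-many j x = begin
    R * m                                                       ≡⟨ length-R×m ⟨
    length (cartesianProduct (allFin R) (allFin m))             ≡⟨ length-map helper (cartesianProduct (allFin R) (allFin m)) ⟨
    length (map helper (cartesianProduct (allFin R) (allFin m)))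
      ≤⟨ Unique⇒length≤ (Uniqueₚ.map⁺ helper-injective Unique-R×m) sub ⟩
    length (filter (helps? v) arrivals)                         ≡⟨ length-filter≡∑ (helps? v) arrivals ⟩
    ∑ arrivals (λ z → 𝟙 (helps? v z)) ∎
    where
    open ≤-Reasoning
    v = vertex (internal j) x
    helper : Fin R × Fin m → Edge graph × Bool
    helper (r , y) = edge (combine j r , x , y) , true
    helper-injective : ∀ {t t′} → helper t ≡ helper t′ → t ≡ t′
    helper-injective {r , y} {r′ , y′} eq with edge-injective (,-injectiveˡ eq)
    ... | eq′ with combine-injective j r j r′ (,-injectiveˡ eq′) | ,-injectiveʳ (,-injectiveʳ eq′)
    ... | _ , refl | refl = refl
    helps : ∀ r y → Helps v (helper (r , y))
    helps r y = sym first , refl , near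
      where
      first : vertex (parent (combine j r)) x ≡ v
      first = cong (λ t → vertex (internal (proj₁ t)) x) (remQuot-combine {J} {R} j r)
      near : toℕ (node (vertex (suc (combine j r)) y)) ≤ R * toℕ (node (vertex (parent (combine j r)) x)) + R
      near = begin
        toℕ (node (vertex (suc (combine j r)) y))                       ≡⟨ cong toℕ (node-vertex (suc (combine j r)) y) ⟩
        suc (toℕ (combine j r))                                         ≡⟨ cong suc (toℕ-combine j r) ⟩
        suc (R * toℕ j + toℕ r)                                         ≡⟨ +-suc (R * toℕ j) (toℕ r) ⟨
        R * toℕ j + suc (toℕ r)                                         ≤⟨ +-monoʳ-≤ (R * toℕ j) (toℕ<n r) ⟩
        R * toℕ j + R                                                   ≡⟨ cong (λ k → R * k + R) (toℕ-inject≤ j J≤1+m) ⟨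
        R * toℕ (internal j) + R                                        ≡⟨ cong (λ a → R * toℕ a + R) (node-vertex (internal j) x) ⟨
        R * toℕ (node (vertex (internal j) x)) + R                      ≡⟨ cong (λ w → R * toℕ (node w) + R) first ⟨
        R * toℕ (node (vertex (parent (combine j r)) x)) + R            ∎
    sub : ∀ {z} → z ∈ map helper (cartesianProduct (allFin R) (allFin m)) → z ∈ filter (helps? v) arrivals
    sub z∈ with ∈-map⁻ helper z∈
    ... | (r , y) , _ , refl = ∈-filter⁺ (helps? v) (∈-cartesianProduct⁺ (edge∈E _) (here refl)) (helps r y)

module _ (J R : ℕ) .{{_ : NonZero J}} .{{_ : NonZero R}} where
  open BlownUpHeap J R

  -- Expected optimum: first-moment bound over dense sets

  module _ (n κ′ : ℕ) (n≤m² : n ≤ m * m) (2≤m : 2 ≤ m) (8≤κ : 8 ≤ 6 + κ′) (2^κ : 2 ^ (6 + κ′) ≡ 8 * R * 32) where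

    private
      κ = 6 + κ′

    Dense : Vec (Edge graph) n → Fin J × List V → Set
    Dense s (j , U) = κ * length U ≤ cnt (insideStar? j U) s

    dense? : ∀ s → Decidable (Dense s)
    dense? s (j , U) = κ * length U ≤? cnt (insideStar? j U) s

    witnesses : List (Fin J × List V)
    -- Sizes are u + 1, which leaves out the empty set: it would count as dense in every sample.
    witnesses = concatMap (λ j → concatMap (λ u → map (j ,_) (combinations (suc u) (star j))) (upTo (suc R * m))) (allFin J)

    ∈-witnesses : ∀ j W → W ⊆ star j → 1 ≤ length W → (j , W) ∈ witnesses
    ∈-witnesses j W W⊆ 1≤ = ∈-concatMap⁺ (λ j → concatMap (λ u → map (j ,_) (combinations (suc u) (star j))) (upTo (suc R * m))) {xs = allFin J}
      (lose (∈-allFin j) (∈-concatMap⁺ (λ u → map (j ,_) (combinations (suc u) (star j))) {xs = upTo (suc R * m)}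
        (lose (∈-upTo⁺ pred<) (∈-map⁺ (j ,_) (subst (λ u → W ∈ combinations u (star j)) (sym sucpred) (∈-combinations⁺ W⊆))))))
      where
      sucpred : suc (pred (length W)) ≡ length W
      sucpred = suc-pred (length W) {{>-nonZero 1≤}}
      pred< : pred (length W) < suc R * m
      pred< = subst₂ _≤_ (sym sucpred) (length-star j) (length-mono-≤ W⊆)

    -- A sample with a dense set gets only the trivial bound n, which the second summand covers. So
    -- an expected number of dense sets of at most 1/n costs just 1.
    opt≤ : ∀ {s} → s ∈ samples graph n → opt graph s ≤ 4 * κ + n * ∑ witnesses (λ w → 𝟙 (dense? s w))
    opt≤ {s} s∈ with any? (dense? s) witnesses
    ... | yes a = ≤-trans (opt≤T graph s) (≤-trans (≤-reflexive (sym (*-identityʳ n)))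
            (≤-trans (*-monoʳ-≤ n (𝟙≤∑𝟙 (yes a) (dense? s) witnesses (λ ¬a → ¬a))) (m≤n+m _ (4 * κ))))
    ... | no ¬a = ≤-trans (opt-sparse s κ (∈-seqs⁻ E n s∈) (λ j W W⊆ 1≤ → ≰⇒> λ d → ¬a (lose (∈-witnesses j W W⊆ 1≤) d)))
            (m≤m+n _ _)

    layer : Fin J → ℕ → ℕ
    layer j u = ∑ (combinations (suc u) (star j)) (λ U → ∑ (samples graph n) (λ s → 𝟙 (dense? s (j , U))))

    layer≤ : ∀ j u → m ^ 5 * layer j u ≤ length E ^ n
    layer≤ j u = core-count (suc u) κ′ m R (length subsets) (layer j u) i (length (star j)) (length E ^ n)
      (s≤s z≤n) 1≤m 1≤R 8≤κ 2^κ (m⊓n≤m (suc u) m) (m⊓n≤n (suc u) m)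
      4N≤ (length-combinations (suc u) (star j)) weighted
      where
      open ≤-Reasoning
      subsets = combinations (suc u) (star j)
      i = suc u ⊓ m
      q = κ * suc u
      4N≤ : 4 * length (star j) ≤ 8 * R * m
      4N≤ = begin
        4 * length (star j)     ≡⟨ cong (4 *_) (length-star j) ⟩
        4 * (suc R * m)         ≤⟨ *-monoʳ-≤ 4 (*-monoˡ-≤ m (+-monoˡ-≤ R 1≤R)) ⟩
        4 * ((R + R) * m)       ≡⟨ regroup R m ⟩
        8 * R * m ∎
        where
        regroup : ∀ R m → 4 * ((R + R) * m) ≡ 8 * R * m
        regroup = solve-∀
      one : ∀ {U} → U ∈ subsets →
        q ! * (m * (m * m)) ^ q * ∑ (samples graph n) (λ s → 𝟙 (dense? s (j , U))) ≤ (m * m * (suc u * i)) ^ q * length E ^ n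
      one {U} U∈ with ∈-combinations⁻ (suc u) (star j) U∈
      ... | _ , |U| = begin
        q ! * (m * (m * m)) ^ q * ∑ (samples graph n) (λ s → 𝟙 (κ * length U ≤? cnt (insideStar? j U) s))
          ≡⟨ cong₂ (λ e u → q ! * e ^ q * ∑ (samples graph n) (λ s → 𝟙 (κ * u ≤? cnt (insideStar? j U) s))) (sym length-edges) |U| ⟩
        q ! * length E ^ q * ∑ (samples graph n) (λ s → 𝟙 (q ≤? cnt (insideStar? j U) s))
          ≤⟨ cnt-tail (insideStar? j U) E n q ⟩
        (n * ∑ E (λ e → 𝟙 (insideStar? j U e))) ^ q * length E ^ n
          ≤⟨ *-monoˡ-≤ (length E ^ n) (^-monoˡ-≤ q (*-mono-≤ n≤m² (≤-trans (insideStar≤ j U) (≤-reflexive (cong (λ u → u * (u ⊓ m)) |U|))))) ⟩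
        (m * m * (suc u * i)) ^ q * length E ^ n ∎
      weighted : q ! * (m * (m * m)) ^ q * layer j u ≤ length subsets * ((m * m * (suc u * i)) ^ q * length E ^ n)
      weighted = ≤-trans (≤-reflexive (sym (∑-* subsets (q ! * (m * (m * m)) ^ q) _)))
        (∑-≤const subsets ((m * m * (suc u * i)) ^ q * length E ^ n) one)

    -- How the m^5 of `layer≤` is spent: m² on the factor n, and m³ on the J stars with (R + 1) m
    -- sizes each, as J (R + 1) m ≤ 2 m² ≤ m³.
    dense-total : n * ∑ (samples graph n) (λ s → ∑ witnesses (λ w → 𝟙 (dense? s w))) ≤ length E ^ n
    dense-total = *-cancelˡ-≤ (m ^ 5) {{m^n≢0 m 5 {{>-nonZero 1≤m}}}} (begin
      m ^ 5 * (n * ∑ (samples graph n) (λ s → ∑ witnesses (λ w → 𝟙 (dense? s w))))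
        ≡⟨ regroup (m ^ 5) n _ ⟩
      n * (m ^ 5 * ∑ (samples graph n) (λ s → ∑ witnesses (λ w → 𝟙 (dense? s w))))
        ≡⟨ cong (λ t → n * (m ^ 5 * t)) by-layers ⟩
      n * (m ^ 5 * ∑ (allFin J) (λ j → ∑ (upTo (suc R * m)) (layer j)))
        ≤⟨ *-monoʳ-≤ n layers≤ ⟩
      n * (J * (suc R * m * M))
        ≤⟨ *-mono-≤ n≤m² (*-monoʳ-≤ J (*-monoˡ-≤ M (*-monoˡ-≤ m (+-monoˡ-≤ R 1≤R)))) ⟩
      m * m * (J * ((R + R) * m * M))
        ≡⟨ regroup′ J R m M ⟩
      m * m * (2 * m * m * M)
        ≤⟨ *-monoʳ-≤ (m * m) (*-monoˡ-≤ M (*-monoˡ-≤ m (*-monoˡ-≤ m 2≤m))) ⟩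
      m * m * (m * m * m * M)
        ≡⟨ regroup″ m M ⟩
      m ^ 5 * M ∎)
      where
      open ≤-Reasoning
      M = length E ^ n
      regroup : ∀ a b c → a * (b * c) ≡ b * (a * c)
      regroup = solve-∀
      regroup′ : ∀ J R m M → m * m * (J * ((R + R) * m * M)) ≡ m * m * (2 * (J * R) * m * M)
      regroup′ = solve-∀
      regroup″ : ∀ m M → m * m * (m * m * m * M) ≡ m * (m * (m * (m * (m * 1)))) * M
      regroup″ = solve-∀
      by-layers : ∑ (samples graph n) (λ s → ∑ witnesses (λ w → 𝟙 (dense? s w))) ≡ ∑ (allFin J) (λ j → ∑ (upTo (suc R * m)) (layer j))
      by-layers = trans (∑-swap (samples graph n) witnesses (λ s w → 𝟙 (dense? s w)))
        (trans (∑-concatMap _ (allFin J) _) (∑-cong (allFin J) λ j →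
          trans (∑-concatMap _ (upTo (suc R * m)) _) (∑-cong (upTo (suc R * m)) λ u →
            ∑-map (j ,_) (combinations (suc u) (star j)) _)))
      layers≤ : m ^ 5 * ∑ (allFin J) (λ j → ∑ (upTo (suc R * m)) (layer j)) ≤ J * (suc R * m * M)
      layers≤ = begin
        m ^ 5 * ∑ (allFin J) (λ j → ∑ (upTo (suc R * m)) (layer j))
          ≡⟨ ∑-* (allFin J) (m ^ 5) _ ⟨
        ∑ (allFin J) (λ j → m ^ 5 * ∑ (upTo (suc R * m)) (layer j))
          ≤⟨ ∑-≤const (allFin J) (suc R * m * M) (λ {j} _ → begin
               m ^ 5 * ∑ (upTo (suc R * m)) (layer j)          ≡⟨ ∑-* (upTo (suc R * m)) (m ^ 5) (layer j) ⟨
               ∑ (upTo (suc R * m)) (λ u → m ^ 5 * layer j u)  ≤⟨ ∑-≤const (upTo (suc R * m)) M (λ {u} _ → layer≤ j u) ⟩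
               length (upTo (suc R * m)) * M                   ≡⟨ cong (_* M) (length-upTo (suc R * m)) ⟩
               suc R * m * M ∎) ⟩
        length (allFin J) * (suc R * m * M)
          ≡⟨ cong (_* (suc R * m * M)) (length-allFin J) ⟩
        J * (suc R * m * M) ∎

    optSum≤ : optSum graph n ≤ suc (4 * κ) * length E ^ n
    optSum≤ = begin
      ∑ (samples graph n) (opt graph)
        ≤⟨ ∑-mono-∈ (samples graph n) opt≤ ⟩
      ∑ (samples graph n) (λ s → 4 * κ + n * ∑ witnesses (λ w → 𝟙 (dense? s w)))
        ≡⟨ ∑-+ (samples graph n) _ _ ⟩
      ∑ (samples graph n) (λ _ → 4 * κ) + ∑ (samples graph n) (λ s → n * ∑ witnesses (λ w → 𝟙 (dense? s w)))
        ≡⟨ cong₂ _+_ const-part (∑-* (samples graph n) n _) ⟩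
      4 * κ * length E ^ n + n * ∑ (samples graph n) (λ s → ∑ witnesses (λ w → 𝟙 (dense? s w)))
        ≤⟨ +-monoʳ-≤ (4 * κ * length E ^ n) dense-total ⟩
      4 * κ * length E ^ n + length E ^ n
        ≡⟨ +-comm (4 * κ * length E ^ n) (length E ^ n) ⟩
      suc (4 * κ) * length E ^ n ∎
      where
      open ≤-Reasoning
      const-part : ∑ (samples graph n) (λ _ → 4 * κ) ≡ 4 * κ * length E ^ n
      const-part = trans (∑-cong (samples graph n) (λ _ → sym (*-identityʳ (4 * κ))))
        (trans (∑-* (samples graph n) (4 * κ) (λ _ → 1)) (cong (4 * κ *_) (∑-seqs-1 E n)))

  -- Greedy: union bound over vertices and phases

  module _ (n t g : ℕ) (room : suc g * (4 * J * m * t) ≤ n) (deep : suc R ^ suc g ≤ J) where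

    private
      h = suc g
      τ = 4 * J * m * t
      bools : List Bool
      bools = true ∷ false ∷ []

    Fails : Vec (Edge graph × Bool) n → (Fin J × Fin m) × ℕ → Set
    Fails z ((j , x) , k) = window (helps? (vertex (internal j) x)) (k * τ) τ z < h

    fails? : ∀ z → Decidable (Fails z)
    fails? z ((j , x) , k) = window (helps? (vertex (internal j) x)) (k * τ) τ z <? h

    windows : List ((Fin J × Fin m) × ℕ)
    windows = cartesianProduct (cartesianProduct (allFin J) (allFin m)) (upTo h)

    -- Starting from zero loads, g + 1 = h phases lift a root vertex to h. By `deep`, every node
    -- that has to climb on the way is among the J nodes with children, over which `windows` ranges.
    h≤greedyMax : ∀ (s : Vec (Edge graph) n) bs → ¬ Any (Fails (zip s bs)) windows → h ≤ greedyMax graph s bs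
    h≤greedyMax s bs ¬fail = ≤-trans (greedyRun-phases s bs τ h ld₀ 0 g τ
        (λ _ _ → z≤n)
        (λ v nv → ≤-trans (≤-trans (s≤s z≤n) (good v (inner nv) 0 (s≤s z≤n))) (m≤n+m _ _))
        (λ v nv k k<g → good v (inner nv) (suc k) (s≤s k<g))
        ≤-refl root (s≤s (≤-reflexive (cong toℕ (node-vertex zero (fromℕ< 1≤m))))))
      (lookup≤maxVec (greedyRun graph ld₀ s bs) root)
      where
      ld₀ = replicate _ 0
      root = vertex zero (fromℕ< 1≤m)
      inner : ∀ {a} → a < suc R ^ g → a < J
      inner a< = ≤-trans a< (≤-trans (m≤m+n _ _) deep)
      good : ∀ v → toℕ (node v) < J → ∀ k → k < h → h ≤ window (helps? v) (k * τ) τ (zip s bs)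
      good v nv k k<h with internal⁻ (node v) nv | vertex-node v
      ... | j , eq | x , eq′ = subst (λ v → h ≤ window (helps? v) (k * τ) τ (zip s bs))
        (trans (cong (λ a → vertex a x) (sym eq)) (sym eq′))
        (≮⇒≥ λ f → ¬fail (lose (∈-cartesianProduct⁺ (∈-cartesianProduct⁺ (∈-allFin j) (∈-allFin x)) (∈-upTo⁺ k<h)) f))

    -- By `helps-many`, the mean weight of an arrival (2, or 1 if helpful) is at most 2 (1 - 1/X)
    -- with X = 4 J m. Over τ = X t arrivals, `2*y^x≤x^x` turns this into a gain of 2^t.
    fails≤ : ∀ j x k → k < h →
      2 ^ t * ∑ (seqs arrivals n) (λ z → 𝟙 (fails? z ((j , x) , k))) ≤ 2 ^ h * length arrivals ^ n
    fails≤ j x k k<h = *-cancelˡ-≤ (2 ^ τ) {{m^n≢0 2 τ}} (begin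
      2 ^ τ * (2 ^ t * F n)                                      ≡⟨ cong (λ n → 2 ^ τ * (2 ^ t * F n)) n≡ ⟩
      2 ^ τ * (2 ^ t * F n′)                                     ≡⟨ regroup (2 ^ τ) (2 ^ t) (F n′) ⟩
      2 ^ t * (2 ^ τ * F n′)                                     ≤⟨ *-monoʳ-≤ (2 ^ t) (window-tail P? arrivals (k * τ) τ r h) ⟩
      2 ^ t * (w ^ τ * (2 ^ h * a ^ (k * τ + r)))                ≡⟨ *-assoc (2 ^ t) (w ^ τ) _ ⟨
      2 ^ t * w ^ τ * (2 ^ h * a ^ (k * τ + r))                  ≤⟨ *-monoˡ-≤ _ weights ⟩
      2 ^ τ * a ^ τ * (2 ^ h * a ^ (k * τ + r))                  ≡⟨ regroup′ (2 ^ τ) (a ^ τ) (2 ^ h) (a ^ (k * τ + r)) ⟩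
      2 ^ τ * (2 ^ h * (a ^ τ * a ^ (k * τ + r)))                ≡⟨ cong (λ t → 2 ^ τ * (2 ^ h * t)) (^-distribˡ-+-* a τ (k * τ + r)) ⟨
      2 ^ τ * (2 ^ h * a ^ (τ + (k * τ + r)))                    ≡⟨ cong (λ n → 2 ^ τ * (2 ^ h * a ^ n)) (trans (regroup″ τ (k * τ) r) (sym n≡)) ⟩
      2 ^ τ * (2 ^ h * a ^ n)                                    ∎)
      where
      open ≤-Reasoning
      v = vertex (internal j) x
      P? = helps? v
      a = length arrivals
      w = ∑ arrivals (λ z → 2 ∸ 𝟙 (P? z))
      X = 4 * J * m
      y = pred X
      F : ℕ → ℕ
      F n = ∑ (seqs arrivals n) (λ z → 𝟙 (window P? (k * τ) τ z <? h))
      r = n ∸ suc k * τ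
      n′ = k * τ + (τ + r)
      n≡ : n ≡ n′
      n≡ = trans (sym (m+[n∸m]≡n (≤-trans (*-monoˡ-≤ τ k<h) room))) (shift (k * τ) τ r)
        where
        shift : ∀ a b c → b + a + c ≡ a + (b + c)
        shift = solve-∀
      regroup : ∀ a b c → a * (b * c) ≡ b * (a * c)
      regroup = solve-∀
      regroup′ : ∀ a b c d → a * b * (c * d) ≡ a * (c * (b * d))
      regroup′ = solve-∀
      regroup″ : ∀ a b c → a + (b + c) ≡ b + (a + c)
      regroup″ = solve-∀
      1≤X : 1 ≤ X
      1≤X = *-mono-≤ (*-mono-≤ {1} {4} (s≤s z≤n) 1≤J) 1≤m
      X≡ : suc y ≡ X
      X≡ = suc-pred X {{>-nonZero 1≤X}}
      2a≡ : a * 2 ≡ X * (R * m)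
      2a≡ = trans (cong (_* 2) (trans length-arrivals (cong (_* 2) length-edges))) (regroup‴ J R m)
        where
        regroup‴ : ∀ J R m → J * R * (m * m) * 2 * 2 ≡ 4 * J * m * (R * m)
        regroup‴ = solve-∀
      w≤ : w ≤ y * (R * m)
      w≤ = +-cancelˡ-≤ (R * m) w (y * (R * m)) (begin
        R * m + w                                                  ≤⟨ +-monoˡ-≤ w (helps-many j x) ⟩
        ∑ arrivals (λ z → 𝟙 (P? z)) + w                            ≡⟨ ∑-+ arrivals _ _ ⟨
        ∑ arrivals (λ z → 𝟙 (P? z) + (2 ∸ 𝟙 (P? z)))               ≡⟨ ∑-cong arrivals (λ z → m+[n∸m]≡n (≤-trans (𝟙≤1 (P? z)) (s≤s z≤n))) ⟩
        ∑ arrivals (λ _ → 2)                                       ≡⟨ ∑-const arrivals 2 ⟩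
        a * 2                                                      ≡⟨ 2a≡ ⟩
        X * (R * m)                                                ≡⟨ cong (_* (R * m)) X≡ ⟨
        R * m + y * (R * m) ∎)
      weights : 2 ^ t * w ^ τ ≤ 2 ^ τ * a ^ τ
      weights = begin
        2 ^ t * w ^ τ                             ≤⟨ *-monoʳ-≤ (2 ^ t) (^-monoˡ-≤ τ w≤) ⟩
        2 ^ t * (y * (R * m)) ^ τ                 ≡⟨ cong (2 ^ t *_) (^-distribʳ-* τ y (R * m)) ⟩
        2 ^ t * (y ^ τ * (R * m) ^ τ)             ≡⟨ *-assoc (2 ^ t) (y ^ τ) _ ⟨
        2 ^ t * y ^ τ * (R * m) ^ τ               ≡⟨ cong (λ s → 2 ^ t * s * (R * m) ^ τ) (^-*-assoc y X t) ⟨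
        2 ^ t * (y ^ X) ^ t * (R * m) ^ τ         ≡⟨ cong (_* (R * m) ^ τ) (^-distribʳ-* t 2 (y ^ X)) ⟨
        (2 * y ^ X) ^ t * (R * m) ^ τ             ≤⟨ *-monoˡ-≤ ((R * m) ^ τ) (^-monoˡ-≤ t (subst (λ X → 2 * y ^ X ≤ X ^ X) X≡ (2*y^x≤x^x y))) ⟩
        (X ^ X) ^ t * (R * m) ^ τ                 ≡⟨ cong (_* (R * m) ^ τ) (^-*-assoc X X t) ⟩
        X ^ τ * (R * m) ^ τ                       ≡⟨ ^-distribʳ-* τ X (R * m) ⟨
        (X * (R * m)) ^ τ                         ≡⟨ cong (_^ τ) (trans (sym 2a≡) (*-comm a 2)) ⟩
        (2 * a) ^ τ                               ≡⟨ ^-distribʳ-* τ 2 a ⟩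
        2 ^ τ * a ^ τ ∎

    greedyCount≤ : ∀ (P : ℕ → Bool) → (∀ k → h ≤ k → ¬ T (P k)) →
      2 ^ t * greedyCount graph n P ≤ J * m * h * (2 ^ h * (length E ^ n * 2 ^ n))
    greedyCount≤ P ¬P = begin
      2 ^ t * greedyCount graph n P
        ≡⟨ cong (2 ^ t *_) (∑-cong (samples graph n) (λ s → length-filterᵇ (λ bs → P (greedyMax graph s bs)) (allBoolVecs n))) ⟩
      2 ^ t * ∑ (samples graph n) (λ s → ∑ (allBoolVecs n) (λ bs → 𝟙 (T? (P (greedyMax graph s bs)))))
        ≤⟨ *-monoʳ-≤ (2 ^ t) (∑-mono (samples graph n) (λ s → ∑-mono (allBoolVecs n) (λ bs →
             𝟙≤∑𝟙 (T? (P (greedyMax graph s bs))) (fails? (zip s bs)) windows (λ ¬fail → ¬P _ (h≤greedyMax s bs ¬fail))))) ⟩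
      2 ^ t * ∑ (samples graph n) (λ s → ∑ (allBoolVecs n) (λ bs → ∑ windows (λ ω → 𝟙 (fails? (zip s bs) ω))))
        ≡⟨ cong (2 ^ t *_) (trans (∑-zip E bools n (λ z → ∑ windows (λ ω → 𝟙 (fails? z ω))))
             (∑-swap (seqs arrivals n) windows (λ z ω → 𝟙 (fails? z ω)))) ⟩
      2 ^ t * ∑ windows (λ ω → ∑ (seqs arrivals n) (λ z → 𝟙 (fails? z ω)))
        ≡⟨ ∑-* windows (2 ^ t) _ ⟨
      ∑ windows (λ ω → 2 ^ t * ∑ (seqs arrivals n) (λ z → 𝟙 (fails? z ω)))
        ≤⟨ ∑-≤const windows (2 ^ h * length arrivals ^ n) each ⟩
      length windows * (2 ^ h * length arrivals ^ n)
        ≡⟨ cong₂ (λ a b → a * (2 ^ h * b)) length-windows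
             (trans (cong (_^ n) length-arrivals) (^-distribʳ-* n (length E) 2)) ⟩
      J * m * h * (2 ^ h * (length E ^ n * 2 ^ n)) ∎
      where
      open ≤-Reasoning
      length-windows : length windows ≡ J * m * h
      length-windows = trans (length-cartesianProduct (cartesianProduct (allFin J) (allFin m)) (upTo h))
        (cong₂ _*_ (trans (length-cartesianProduct (allFin J) (allFin m)) (cong₂ _*_ (length-allFin J) (length-allFin m))) (length-upTo h))
      each : ∀ {ω} → ω ∈ windows → 2 ^ t * ∑ (seqs arrivals n) (λ z → 𝟙 (fails? z ω)) ≤ 2 ^ h * length arrivals ^ n
      each {(j , x) , k} ω∈ = fails≤ j x k (∈-upTo⁻ (proj₂ (∈-cartesianProduct⁻ (cartesianProduct (allFin J) (allFin m)) (upTo h) ω∈)))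

-- Choice of parameters

module Parameters (n : ℕ) where

  -- Makes R = 256 · 4^(LL n) exceed 64 (L n)². This is what `room` needs: at most ℓ phases of 16 J
  -- m ℓ arrivals take 16 ℓ² m² / R ≤ 64 ℓ² n / R in all.
  b : ℕ
  b = 2 * LL n + 8

  -- Chosen so that m = 2^(p + b) = 2^(H + 1) with H = ⌊ L n /2⌋, which puts m² between n and 4n.
  p : ℕ
  p = suc ⌊ L n /2⌋ ∸ b

  J R : ℕ
  J = 2 ^ p
  R = 2 ^ b

  instance
    J≢0 : NonZero J
    J≢0 = m^n≢0 2 p
    R≢0 : NonZero R
    R≢0 = m^n≢0 2 b

  open BlownUpHeap J R {{J≢0}} {{R≢0}} public

  -- The degree bound sets the threshold: 2 (R + 1) ≤ 4R = 1024 · 4^(LL n) must stay below ℓ³. It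
  -- also yields LL n ≥ 10, where `linear≤exp` starts.
  module Large (ℓ≥ : 1024 ≤ L n) where
    open ≤-Reasoning

    ℓ = L n
    λ′ = LL n
    H = ⌊ ℓ /2⌋

    2H≤ℓ : H + H ≤ ℓ
    2H≤ℓ = ≤-trans (+-monoʳ-≤ H (⌊n/2⌋≤⌈n/2⌉ ℓ)) (≤-reflexive (⌊n/2⌋+⌈n/2⌉≡n ℓ))

    ℓ≤2H+1 : ℓ ≤ suc (H + H)
    ℓ≤2H+1 = ≤-trans (s≤s⁻¹ (≤-trans (≤-reflexive (sym (⌊n/2⌋+⌈n/2⌉≡n (suc ℓ)))) (+-monoˡ-≤ ⌈ suc ℓ /2⌉ (half-suc ℓ))))
      (≤-reflexive (+-suc H H))
      where
      half-suc : ∀ k → ⌊ suc k /2⌋ ≤ suc ⌊ k /2⌋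
      half-suc zero = z≤n
      half-suc (suc zero) = ≤-refl
      half-suc (suc (suc k)) = s≤s (half-suc k)

    1≤n : 1 ≤ n
    1≤n = ≢0 n ℓ≥
      where
      ≢0 : ∀ n → 1024 ≤ L n → 1 ≤ n
      ≢0 (suc _) _ = s≤s z≤n

    2^ℓ≤n : 2 ^ ℓ ≤ n
    2^ℓ≤n = 2^log≤n n 1≤n

    n<2^1+ℓ : n < 2 ^ suc ℓ
    n<2^1+ℓ = n<2^[1+log] n

    2^λ≤ℓ : 2 ^ λ′ ≤ ℓ
    2^λ≤ℓ = 2^log≤n ℓ (≤-trans (s≤s z≤n) ℓ≥)

    ℓ<2^1+λ : ℓ < 2 ^ suc λ′
    ℓ<2^1+λ = n<2^[1+log] ℓ

    λ≥10 : 10 ≤ λ′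
    λ≥10 = subst (_≤ λ′) (⌊log₂[2^n]⌋≡n 10) (⌊log₂⌋-mono-≤ ℓ≥)

    linear≤exp : ∀ k → 10 ≤ k → 8 * k + 37 ≤ 2 ^ k
    linear≤exp k 10≤k = subst (λ k → 8 * k + 37 ≤ 2 ^ k) (m+[n∸m]≡n 10≤k) (go (k ∸ 10))
      where
      go : ∀ d → 8 * (10 + d) + 37 ≤ 2 ^ (10 + d)
      go zero = m≤m+n 117 907
      go (suc d) = begin
        8 * (10 + suc d) + 37                      ≡⟨ step d ⟩
        8 + (8 * (10 + d) + 37)                    ≤⟨ +-mono-≤ (≤-trans (m≤m+n 8 1016) (^-monoʳ-≤ 2 (m≤m+n 10 d))) (go d) ⟩
        2 ^ (10 + d) + 2 ^ (10 + d)                ≡⟨ cong (2 ^ (10 + d) +_) (+-identityʳ (2 ^ (10 + d))) ⟨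
        2 ^ suc (10 + d)                           ≡⟨ cong (2 ^_) (+-suc 10 d) ⟨
        2 ^ (10 + suc d) ∎
        where
        step : ∀ d → 8 * (10 + (1 + d)) + 37 ≡ 8 + (8 * (10 + d) + 37)
        step = solve-∀

    2*[1+b]≤H : 2 * suc b ≤ H
    2*[1+b]≤H = *-cancelˡ-≤ 2 (s≤s⁻¹ (begin
      suc (2 * (2 * suc b))     ≡⟨ eq λ′ ⟩
      8 * λ′ + 37               ≤⟨ linear≤exp λ′ λ≥10 ⟩
      2 ^ λ′                    ≤⟨ 2^λ≤ℓ ⟩
      ℓ                         ≤⟨ ℓ≤2H+1 ⟩
      suc (H + H)               ≡⟨ cong (λ t → suc (H + t)) (+-identityʳ H) ⟨
      suc (2 * H) ∎))
      where
      eq : ∀ l → 1 + 2 * (2 * (1 + (2 * l + 8))) ≡ 8 * l + 37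
      eq = solve-∀

    p+b : p + b ≡ suc H
    p+b = m∸n+n≡m (≤-trans (n≤1+n b) (≤-trans (m≤m+n (suc b) _) (≤-trans 2*[1+b]≤H (n≤1+n H))))

    m≡ : m ≡ 2 ^ suc H
    m≡ = trans (sym (^-distribˡ-+-* 2 p b)) (cong (2 ^_) p+b)

    m²≡ : m * m ≡ 2 ^ (suc H + suc H)
    m²≡ = trans (cong₂ _*_ m≡ m≡) (sym (^-distribˡ-+-* 2 (suc H) (suc H)))

    n≤m² : n ≤ m * m
    n≤m² = begin
      n                       ≤⟨ <⇒≤ n<2^1+ℓ ⟩
      2 ^ suc ℓ               ≤⟨ ^-monoʳ-≤ 2 (s≤s ℓ≤2H+1) ⟩
      2 ^ (2 + (H + H))       ≡⟨ cong (2 ^_) (cong suc (+-suc H H)) ⟨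
      2 ^ (suc H + suc H)     ≡⟨ m²≡ ⟨
      m * m ∎

    m²≤4n : m * m ≤ 4 * n
    m²≤4n = begin
      m * m                   ≡⟨ m²≡ ⟩
      2 ^ (suc H + suc H)     ≡⟨ cong (2 ^_) (cong suc (+-suc H H)) ⟩
      2 ^ (2 + (H + H))       ≤⟨ ^-monoʳ-≤ 2 (+-monoʳ-≤ 2 2H≤ℓ) ⟩
      2 ^ (2 + ℓ)             ≡⟨ ^-distribˡ-+-* 2 2 ℓ ⟩
      4 * 2 ^ ℓ               ≤⟨ *-monoʳ-≤ 4 2^ℓ≤n ⟩
      4 * n ∎

    2≤m : 2 ≤ m
    2≤m = subst (2 ≤_) (sym m≡) (^-monoʳ-≤ 2 {1} {suc H} (s≤s z≤n))

    1≤λ : 1 ≤ λ′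
    1≤λ = ≤-trans (s≤s z≤n) λ≥10

    c≤cλ : ∀ c → c ≤ c * λ′
    c≤cλ c = ≤-trans (≤-reflexive (sym (*-identityʳ c))) (*-monoʳ-≤ c 1≤λ)

    n≤nV : n ≤ 1 * nV graph
    n≤nV = ≤-trans n≤m² (≤-trans (m≤n+m (m * m) m) (≤-reflexive (sym (+-identityʳ _))))

    nV≤8n : nV graph ≤ 8 * n
    nV≤8n = begin
      m + m * m               ≤⟨ +-monoˡ-≤ (m * m) (m≤n*m m m {{>-nonZero 1≤m}}) ⟩
      m * m + m * m           ≤⟨ +-mono-≤ m²≤4n m²≤4n ⟩
      4 * n + 4 * n           ≡⟨ *-distribʳ-+ n 4 4 ⟨
      8 * n ∎

    n≤degree² : ∀ v → n ≤ degree graph v * degree graph v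
    n≤degree² v = ≤-trans n≤m² (*-mono-≤ (m≤degree v) (m≤degree v))

    R≡ : R ≡ 256 * (2 ^ λ′ * 2 ^ λ′)
    R≡ = trans (^-distribˡ-+-* 2 (2 * λ′) 8) (trans (*-comm (2 ^ (2 * λ′)) 256)
      (cong (256 *_) (trans (cong (2 ^_) (cong (λ′ +_) (+-identityʳ λ′))) (^-distribˡ-+-* 2 λ′ λ′))))

    2*[1+R]≤ℓ³ : 2 * suc R ≤ ℓ * ℓ * ℓ
    2*[1+R]≤ℓ³ = begin
      2 * suc R                             ≤⟨ *-monoʳ-≤ 2 (+-monoˡ-≤ R 1≤R) ⟩
      2 * (R + R)                           ≡⟨ cong (λ r → 2 * (r + r)) R≡ ⟩
      2 * (256 * X + 256 * X)               ≡⟨ regroup X ⟩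
      X * 1024                              ≤⟨ *-mono-≤ (*-mono-≤ 2^λ≤ℓ 2^λ≤ℓ) ℓ≥ ⟩
      ℓ * ℓ * ℓ ∎
      where
      X = 2 ^ λ′ * 2 ^ λ′
      regroup : ∀ x → 2 * (256 * x + 256 * x) ≡ x * 1024
      regroup = solve-∀

    degree²≤ : ∀ v → degree graph v * degree graph v ≤ n * ℓ ^ 6
    degree²≤ v = begin
      degree graph v * degree graph v       ≤⟨ *-mono-≤ (degree≤ v) (degree≤ v) ⟩
      suc R * m * (suc R * m)               ≡⟨ regroup (suc R) m ⟩
      suc R * suc R * (m * m)               ≤⟨ *-monoʳ-≤ (suc R * suc R) m²≤4n ⟩
      suc R * suc R * (4 * n)               ≡⟨ regroup′ (suc R) n ⟩
      n * (2 * suc R * (2 * suc R))         ≤⟨ *-monoʳ-≤ n (*-mono-≤ 2*[1+R]≤ℓ³ 2*[1+R]≤ℓ³) ⟩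
      n * (ℓ * ℓ * ℓ * (ℓ * ℓ * ℓ))         ≡⟨ regroup″ n ℓ ⟩
      n * ℓ ^ 6 ∎
      where
      regroup : ∀ r m → r * m * (r * m) ≡ r * r * (m * m)
      regroup = solve-∀
      regroup′ : ∀ r n → r * r * (4 * n) ≡ n * (2 * r * (2 * r))
      regroup′ = solve-∀
      regroup″ : ∀ n l → n * (l * l * l * (l * l * l)) ≡ n * (l * (l * (l * (l * (l * (l * 1))))))
      regroup″ = solve-∀

    optSum-bound : optSum graph n ≤ 73 * LL n * length (edges graph) ^ n
    optSum-bound = ≤-trans (optSum≤ J R n κ′ n≤m² 2≤m (m≤m+n 8 (2 * λ′ + 8)) 2^κ)
      (*-monoˡ-≤ (length E ^ n) (begin
        suc (4 * (6 + κ′))      ≡⟨ eq λ′ ⟩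
        8 * λ′ + 65             ≤⟨ +-monoʳ-≤ (8 * λ′) (c≤cλ 65) ⟩
        8 * λ′ + 65 * λ′        ≡⟨ *-distribʳ-+ λ′ 8 65 ⟨
        73 * λ′ ∎))
      where
      -- So κ = 6 + κ′ = b + 8 and 2^κ = 256 R; the total 1 + 4κ is 8 λ′ + 65.
      κ′ = 2 + (2 * λ′ + 8)
      eq : ∀ l → 1 + 4 * (6 + (2 + (2 * l + 8))) ≡ 8 * l + 65
      eq = solve-∀
      2^κ : 2 ^ (6 + κ′) ≡ 8 * R * 32
      2^κ = trans (^-distribˡ-+-* 2 8 b) (regroup R)
        where
        regroup : ∀ r → 256 * r ≡ 8 * r * 32
        regroup = solve-∀

    d = H / suc b

    2≤d : 2 ≤ d
    2≤d = subst (_≤ d) (m*n/n≡m 2 (suc b)) (/-monoˡ-≤ (suc b) 2*[1+b]≤H)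

    -- There are g + 1 = d - 1 phases. The unit of b + 1 given up from H covers the b by which the
    -- exponent p of J falls short of H + 1.
    g = d ∸ 2

    g+2 : suc (suc g) ≡ d
    g+2 = m+[n∸m]≡n 2≤d

    [2+g]*[1+b]≤H : suc (suc g) * suc b ≤ H
    [2+g]*[1+b]≤H = subst (λ d → d * suc b ≤ H) (sym g+2) (m/n*n≤m H (suc b))

    deep : suc R ^ suc g ≤ J
    deep = begin
      suc R ^ suc g                     ≤⟨ ^-monoˡ-≤ (suc g) (+-mono-≤ 1≤R (≤-reflexive (sym (+-identityʳ R)))) ⟩
      (2 ^ suc b) ^ suc g               ≡⟨ ^-*-assoc 2 (suc b) (suc g) ⟩
      2 ^ (suc b * suc g)               ≤⟨ ^-monoʳ-≤ 2 (+-cancelʳ-≤ b (suc b * suc g) p fits) ⟩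
      J ∎
      where
      fits : suc b * suc g + b ≤ p + b
      fits = begin
        suc b * suc g + b               ≤⟨ m≤n+m _ 1 ⟩
        1 + (suc b * suc g + b)         ≡⟨ eq b g ⟩
        suc (suc g) * suc b             ≤⟨ [2+g]*[1+b]≤H ⟩
        H                               ≤⟨ n≤1+n H ⟩
        suc H                           ≡⟨ p+b ⟨
        p + b ∎
        where
        eq : ∀ b g → 1 + ((1 + b) * (1 + g) + b) ≡ (1 + (1 + g)) * (1 + b)
        eq = solve-∀

    1+g≤ℓ : suc g ≤ ℓ
    1+g≤ℓ = begin
      suc g                     ≤⟨ n≤1+n (suc g) ⟩
      suc (suc g)               ≤⟨ m≤m*n (suc (suc g)) (suc b) ⟩
      suc (suc g) * suc b       ≤⟨ [2+g]*[1+b]≤H ⟩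
      H                         ≤⟨ m≤m+n H H ⟩
      H + H                     ≤⟨ 2H≤ℓ ⟩
      ℓ ∎

    room : suc g * (4 * J * m * (4 * ℓ)) ≤ n
    room = *-cancelʳ-≤ _ n R (begin
      suc g * (4 * J * m * (4 * ℓ)) * R           ≤⟨ *-monoˡ-≤ R (*-monoˡ-≤ (4 * J * m * (4 * ℓ)) 1+g≤ℓ) ⟩
      ℓ * (4 * J * m * (4 * ℓ)) * R               ≡⟨ regroup ℓ J R m ⟩
      16 * (ℓ * ℓ) * (m * m)                      ≤⟨ *-mono-≤ (*-monoʳ-≤ 16 (*-mono-≤ (<⇒≤ ℓ<2^1+λ) (<⇒≤ ℓ<2^1+λ))) m²≤4n ⟩
      16 * (2 * Y * (2 * Y)) * (4 * n)            ≡⟨ regroup′ Y n ⟩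
      n * (256 * (Y * Y))                         ≡⟨ cong (n *_) R≡ ⟨
      n * R ∎)
      where
      Y = 2 ^ λ′
      regroup : ∀ l J R m → l * (4 * J * m * (4 * l)) * R ≡ 16 * (l * l) * (J * R * m)
      regroup = solve-∀
      regroup′ : ∀ y n → 16 * (2 * y * (2 * y)) * (4 * n) ≡ n * (256 * (y * y))
      regroup′ = solve-∀

    -- Here 66 = 2 · 3 · 11, from ℓ ≤ 2 (H + 1), H + 1 ≤ (d + 1)(b + 1), d + 1 = g + 3 ≤ 3 (g + 1)
    -- and b + 1 = 2 λ′ + 9 ≤ 11 λ′. Loads of at least h therefore fail `low-load`.
    ℓ≤66hλ : ∀ k → suc g ≤ k → ℓ ≤ 66 * k * λ′
    ℓ≤66hλ k h≤k = begin
      ℓ                                     ≤⟨ ℓ≤2H+1 ⟩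
      suc (H + H)                           ≤⟨ n≤1+n _ ⟩
      2 + (H + H)                           ≡⟨ cong suc (+-suc H H) ⟨
      suc H + suc H                         ≤⟨ +-mono-≤ H< H< ⟩
      3 * k * (11 * λ′) + 3 * k * (11 * λ′) ≡⟨ regroup k λ′ ⟩
      66 * k * λ′ ∎
      where
      regroup : ∀ k l → 3 * k * (11 * l) + 3 * k * (11 * l) ≡ 66 * k * l
      regroup = solve-∀
      regroup′ : ∀ l → 1 + (2 * l + 8) ≡ 2 * l + 9
      regroup′ = solve-∀
      3+g≤ : suc d ≤ 3 * k
      3+g≤ = begin
        suc d                   ≡⟨ cong suc g+2 ⟨
        3 + g                   ≤⟨ +-monoʳ-≤ 3 (m≤n*m g 3) ⟩
        3 + 3 * g               ≡⟨ *-suc 3 g ⟨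
        3 * suc g               ≤⟨ *-monoʳ-≤ 3 h≤k ⟩
        3 * k ∎
      1+b≤ : suc b ≤ 11 * λ′
      1+b≤ = begin
        suc b                   ≡⟨ regroup′ λ′ ⟩
        2 * λ′ + 9              ≤⟨ +-monoʳ-≤ (2 * λ′) (c≤cλ 9) ⟩
        2 * λ′ + 9 * λ′         ≡⟨ *-distribʳ-+ λ′ 2 9 ⟨
        11 * λ′ ∎
      H< : suc H ≤ 3 * k * (11 * λ′)
      H< = begin
        suc H                             ≡⟨ cong suc (m≡m%n+[m/n]*n H (suc b)) ⟩
        suc (H % suc b) + d * suc b       ≤⟨ +-monoˡ-≤ (d * suc b) (m%n<n H (suc b)) ⟩
        suc d * suc b                     ≤⟨ *-mono-≤ 3+g≤ 1+b≤ ⟩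
        3 * k * (11 * λ′) ∎

    module _ (q : ℕ) (q+3≤ℓ : q + 3 ≤ ℓ) where

      low-load : ℕ → Bool
      low-load k = 66 * k * LL n <ᵇ L n

      greedyCount-bound : q * greedyCount graph n low-load ≤ length (edges graph) ^ n * 2 ^ n
      greedyCount-bound = *-cancelˡ-≤ 8 (begin
        8 * (q * K)                               ≡⟨ *-assoc 8 q K ⟨
        8 * q * K                                 ≤⟨ *-monoˡ-≤ K 8q≤ ⟩
        x * K                                     ≤⟨ *-cancelˡ-≤ (x * x * x) {{m*n≢0 (x * x) x {{m*n≢0 x x}}}} cubed ⟩
        8 * W ∎)
        where
        K = greedyCount graph n low-load
        W = length E ^ n * 2 ^ n
        x = 2 ^ ℓ
        instance
          x≢0 : NonZero x
          x≢0 = m^n≢0 2 ℓ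
        8q≤ : 8 * q ≤ x
        8q≤ = begin
          8 * q                 ≤⟨ *-monoʳ-≤ 8 (<⇒≤ (n<2^n q)) ⟩
          8 * 2 ^ q             ≡⟨ trans (*-comm 8 (2 ^ q)) (sym (^-distribˡ-+-* 2 q 3)) ⟩
          2 ^ (q + 3)           ≤⟨ ^-monoʳ-≤ 2 q+3≤ℓ ⟩
          x ∎
        h≤x : suc g ≤ x
        h≤x = ≤-trans 1+g≤ℓ (<⇒≤ (n<2^n ℓ))
        Jm≤ : J * m ≤ 8 * x
        Jm≤ = begin
          J * m                 ≤⟨ *-monoˡ-≤ m (m≤m*n J R) ⟩
          m * m                 ≤⟨ m²≤4n ⟩
          4 * n                 ≤⟨ *-monoʳ-≤ 4 (<⇒≤ n<2^1+ℓ) ⟩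
          4 * (2 * x)           ≡⟨ *-assoc 4 2 x ⟨
          8 * x ∎
        -- With t = 4ℓ the gain is x^4. The vertices cost 8x, the phases x and the factor 2^h
        -- another x, so the failure probability is at most 8/x.
        cubed : x * x * x * (x * K) ≤ x * x * x * (8 * W)
        cubed = begin
          x * x * x * (x * K)                           ≡⟨ regroup x K ⟩
          x * (x * (x * (x * 1))) * K                   ≡⟨ cong (_* K) (trans (^-*-assoc 2 ℓ 4) (cong (2 ^_) (*-comm ℓ 4))) ⟩
          2 ^ (4 * ℓ) * K                               ≤⟨ greedyCount≤ J R n (4 * ℓ) g room deep low-load
                                                             (λ k h≤k low → <⇒≱ (<ᵇ⇒< _ _ low) (ℓ≤66hλ k h≤k)) ⟩
          J * m * suc g * (2 ^ suc g * W)               ≤⟨ *-mono-≤ (*-mono-≤ Jm≤ h≤x) (*-monoˡ-≤ W (^-monoʳ-≤ 2 1+g≤ℓ)) ⟩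
          8 * x * x * (x * W)                           ≡⟨ regroup′ x W ⟩
          x * x * x * (8 * W) ∎
          where
          regroup : ∀ x k → x * x * x * (x * k) ≡ x * (x * (x * (x * 1))) * k
          regroup = solve-∀
          regroup′ : ∀ x w → 8 * x * x * (x * w) ≡ x * x * x * (8 * w)
          regroup′ = solve-∀

L≥ : ∀ k {n} → 2 ^ k ≤ n → k ≤ L n
L≥ k le = subst (_≤ _) (⌊log₂[2^n]⌋≡n k) (⌊log₂⌋-mono-≤ le)

theorem1p2 : Σ (ℕ → Graph) λ G → Σ ℕ λ n₀ → Σ ℕ λ a → Σ ℕ λ b → Σ ℕ λ c → Σ ℕ λ C →
    ((n : ℕ) → n₀ ≤ n →
    (n ≤ a * nV (G n)) × (nV (G n) ≤ b * n)
    × ((v : Fin (nV (G n))) →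
    (n ≤ degree (G n) v * degree (G n) v)
    × (degree (G n) v * degree (G n) v ≤ n * L n ^ 6))
    × (optSum (G n) n ≤ C * LL n * length (edges (G n)) ^ n))
    × ((q : ℕ) → Σ ℕ λ n₁ → (n : ℕ) → n₁ ≤ n →
    q * greedyCount (G n) n (λ m → c * m * LL n <ᵇ L n)
    ≤ length (edges (G n)) ^ n * 2 ^ n)
theorem1p2 = Parameters.graph , 2 ^ 1024 , 1 , 8 , 66 , 73 ,
  (λ n n≥ → let open Parameters.Large n (L≥ 1024 n≥) in
    n≤nV , nV≤8n , (λ v → n≤degree² v , degree²≤ v) , optSum-bound) ,
  -- This threshold gives L n ≥ q + 1024, enough for both 1024 ≤ L n and q + 3 ≤ L n.
  (λ q → 2 ^ (q + 1024) , λ n n≥ → let q+1024≤ = L≥ (q + 1024) n≥ in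
    Parameters.Large.greedyCount-bound n (≤-trans (m≤n+m 1024 q) q+1024≤) q
      (≤-trans (+-monoʳ-≤ q (m≤m+n 3 1021)) q+1024≤))
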